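{- If the formal mathematical system $[M;\mathcal{L}]$ has a model $\mathcal{D}$, then it is consistent.
   Context: **Syntax.** $X=\{\mathbf{x}_1,\mathbf{x}_2,\ldots\}$ is the countably infinite alphabet of variables. Let $A$ be a set of constant/operation symbols and $P$ a set of predicate symbols. $A$-lists are the strings generated by: every $x\in X$ and every $a\in A$ is an $A$-list; if $\lambda$ is an $A$-list and $f\in A$ then $f(\lambda)$ is an $A$-list; if $\lambda,\mu$ are $A$-lists then the concatenation $\lambda\mu$ is an $A$-list. $\mathrm{var}(\lambda)$ is the set of variables occurring in $\lambda$; $\lambda\frac{\mu}{x}$ is the list obtained by replacing $x$ everywhere in $\lambda$ by $\mu$. Formulas are written in prefix notation. Prime formulas are $\sim\lambda,\mu$ (equality), $p$, and $p\,\lambda_1,\ldots,\lambda_n$ for $p\in P$, $n\ge1$ and argument lists $\lambda,\mu,\lambda_i$ (a predicate symbol may be used with any number of arguments). If $F,G$ are formulas and $x\in X$, then $\neg F$, $\to FG$, $\leftrightarrow FG$, $\&FG$, $\vee FG$, $\forall xF$, $\exists xF$ are formulas. $\mathrm{free}(F)$ is the set of variables occurring free in $F$; $F$ is closed if $\mathrm{free}(F)=\emptyset$. $F\frac{\lambda}{x}=\mathrm{SbF}(F;\lambda;x)$ is the result of replacing every free occurrence of $x$ in $F$ by $\lambda$. The condition $\mathrm{CF}(F;\lambda;x)$ says that this substitution is collision-free: no free occurrence of $x$ in $F$ lies in the scope of a quantifier $\forall y$ or $\exists y$ with $y\in\mathrm{var}(\lambda)$. **Formal mathematical systems.** $[M;\mathcal{L}]$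 with $M=[A;P;B]$ consists of $A$, $P$, a set $\mathcal{L}$ of $A$-lists with $X\subseteq\mathcal{L}$ and $\lambda\frac{\mu}{x}\in\mathcal{L}$ for all $\lambda,\mu\in\mathcal{L}$, $x\in X$, and a set $B$ of formulas (basis axioms) with all argument lists in $\mathcal{L}$. Formulas of $[M;\mathcal{L}]$ are the formulas over $A,P$ all of whose argument lists are in $\mathcal{L}$. $\Pi(M;\mathcal{L})$ is the set of formulas of $[M;\mathcal{L}]$ provable by the following Hilbert-style calculus, in which all formulas have argument lists in $\mathcal{L}$. Axioms: the formulas in $B$; all $\alpha(F_1,\ldots,F_j)$ for propositional tautologies $\alpha$; equality axioms $\sim x,x$; $\to\mathrm{SbF}(\sim\lambda,\mu;x;y)\to\sim x,y\,\sim\lambda,\mu$ ($x,y\in X$, $\lambda,\mu\in\mathcal{L}$); $\to\sim x_1,y_1\ldots\to\sim x_n,y_n\to p\,x_1,\ldots,x_n\;p\,y_1,\ldots,y_n$ ($p\in P$, $n\ge1$, $x_i,y_i\in X$); quantifier axioms $\to\forall xF\,F$; $\to\forall x\to FG\;\to F\,\forall xG$ if $x\notin\mathrm{free}(F)$; $\leftrightarrow\neg\forall x\neg F\;\exists xF$. Rules: (a) axioms may be written down; (b) from $F$ and $\to FG$ infer $G$; (c) from $F$ infer $F\frac{\lambda}{x}$ if $x\in X$, $\lambda\in\mathcal{L}$ and $\mathrm{CF}(F;\lambda;x)$; (d) from $F$ infer $\forall xF$. $[M;\mathcal{L}]$ is contradictory if every formula of $[M;\mathcal{L}]$ is in $\Pi(M;\mathcal{L})$;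 otherwise it is consistent. **Models.** A model $\mathcal{D}$ of $[M;\mathcal{L}]$ consists of: (1) a nonempty set $\mathcal{D}_*$ (universe; its members are individuals); (2) for each $d\in\mathcal{D}_*$ exactly one name $\alpha_d$, with different individuals having different names; $\mathcal{N}=\{\alpha_d:d\in\mathcal{D}_*\}$ consists of symbols different from those of $[M;\mathcal{L}]$; (3) the extended system $[\hat M;\hat{\mathcal{L}}]$ with $\hat A=A\cup\mathcal{N}$, $\hat M=[\hat A;P;B]$, $\hat{\mathcal{L}}=\{\lambda\frac{\kappa_1}{x_1}\ldots\frac{\kappa_m}{x_m}:\lambda\in\mathcal{L},x_i\in X,\kappa_i\in\mathcal{N},m\ge0\}$; $\hat{\mathcal{L}}_*$ is the set of $\lambda\in\hat{\mathcal{L}}$ with $\mathrm{var}(\lambda)=\emptyset$; (4) a surjective function $\mathcal{D}:\hat{\mathcal{L}}_*\to\mathcal{D}_*$ with $\mathcal{D}(\lambda\frac{\mu}{x})=\mathcal{D}(\lambda\frac{\alpha_{\mathcal{D}(\mu)}}{x})$ for all $\mu\in\hat{\mathcal{L}}_*$, $x\in X$, $\lambda\in\hat{\mathcal{L}}$ with $\mathrm{var}(\lambda)\subseteq\{x\}$; (5) for each $p\in P$ and $n\in\mathbb{N}_0$ an $n$-ary predicate $p_n\subseteq\mathcal{D}_*^n$, where for $n=0$, $p_0\in\{\top,\bot\}$ is a truth value; (6) an extension of $\mathcal{D}$ assigning a truth value to each closed formula of $[\hat M;\hat{\mathcal{L}}]$: $\mathcal{D}(\sim\lambda,\mu)=\top$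 iff $\mathcal{D}(\lambda)=\mathcal{D}(\mu)$; $\mathcal{D}(p)=p_0$; $\mathcal{D}(p\,\lambda_1,\ldots,\lambda_n)=\top$ iff $(\mathcal{D}(\lambda_1),\ldots,\mathcal{D}(\lambda_n))\in p_n$; the connectives $\neg,\to,\leftrightarrow,\&,\vee$ are interpreted classically; for $\mathrm{free}(F)\subseteq\{x\}$, $\mathcal{D}(\forall xF)=\top$ iff $\mathcal{D}(F\frac{\lambda}{x})=\top$ for all $\lambda\in\hat{\mathcal{L}}_*$, and $\mathcal{D}(\exists xF)=\top$ iff $\mathcal{D}(F\frac{\lambda}{x})=\top$ for some $\lambda\in\hat{\mathcal{L}}_*$; (7) a formula $F$ of $[\hat M;\hat{\mathcal{L}}]$ with $\mathrm{free}(F)=\{x_1,\ldots,x_m\}$ is called valid in $\mathcal{D}$ iff $\mathcal{D}(F\frac{\lambda_1}{x_1}\ldots\frac{\lambda_m}{x_m})=\top$ for all $\lambda_1,\ldots,\lambda_m\in\hat{\mathcal{L}}_*$; (8) every $F\in B$ is valid in $\mathcal{D}$. -}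

module Defs where

open import Data.Bool.Base using (Bool; true; false; not; _∧_; _∨_; if_then_else_)
open import Data.Empty.Polymorphic using (⊥)
open import Data.Fin.Base using (Fin)
open import Data.Irrelevant using (Irrelevant; [_])
open import Data.List.Base as List using (List; _∷_; []; _++_; concatMap)
open import Data.List.Membership.Propositional using (_∈_; _∉_)
open import Data.List.Membership.Propositional.Properties using (∈-++⁻; ∈-++⁺ˡ; ∈-++⁺ʳ)
open import Data.List.Properties using (concatMap-++; map-++)
open import Data.List.Relation.Unary.Any using (here; there)
open import Data.List.Relation.Unary.Unique.Propositional using (Unique)
open import Data.Nat.Base using (ℕ; zero; suc; _⊔_; _<_)
open import Data.Nat.Properties using (_≟_; <-irrefl; <-≤-trans; m≤m⊔n; m≤n⊔m)
open import Data.Product.Base using (∃; _×_; _,_; proj₁; proj₂)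
open import Data.Refinement.Base using (Refinement; Refinement-syntax; value; _,_)
open import Data.Sum.Base using (_⊎_; inj₁; inj₂)
open import Data.Unit.Polymorphic using (⊤; tt)
open import Data.Vec.Base as Vec using (Vec; _∷_; [])
open import Data.Vec.Relation.Unary.All as All using (All; _∷_; [])
import Data.Vec.Relation.Unary.All.Properties as All
open import Data.Vec.Relation.Unary.Any as Any using (Any)
import Data.Vec.Relation.Unary.Any.Properties as Any
open import Function.Base using (_∘_)
open import Function.Bundles using (_⇔_; module Equivalence)
open import Function.Definitions using (Bijective; Surjective)
open import Level using (Level) renaming (suc to lsuc)
open import Relation.Binary.PropositionalEquality
  using (_≡_; _≢_; refl; sym; trans; cong; cong₂; subst; module ≡-Reasoning)
open import Relation.Nullary using (¬_; yes; no; does; contradiction)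
open import Relation.Nullary.Decidable using (dec-true; dec-false)
open import Relation.Unary using (Pred)

private
  variable
    ℓ   : Level
    T   : Set ℓ

-- The index n stands for the variable 𝐱ₙ₊₁.

Var : Set
Var = ℕ

data Symbol (A : Set ℓ) : Set ℓ where
  var       : Var → Symbol A
  op        : A → Symbol A
  lpar rpar : Symbol A

Str : Set ℓ → Set ℓ
Str A = List (Symbol A)

⟪_⟫ : Var → Str T
⟪ x ⟫ = var x ∷ []

-- A-lists are literally strings, so concatenation is associative on the nose.

data IsAList {A : Set ℓ} : Str A → Set ℓ where
  var : ∀ x → IsAList ⟪ x ⟫
  op  : ∀ a → IsAList (op a ∷ [])
  app : ∀ f {s} → IsAList s → IsAList (op f ∷ lpar ∷ s ++ rpar ∷ [])
  cat : ∀ {s t} → IsAList s → IsAList t → IsAList (s ++ t)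

_∈var_ : {A : Set ℓ} → Var → Str A → Set ℓ
x ∈var s = var x ∈ s

substSymbol : Str T → Var → Symbol T → Str T
substSymbol t x (var y) = if does (y ≟ x) then t else ⟪ y ⟫
substSymbol t x c       = c ∷ []

_[_/_] : Str T → Str T → Var → Str T
s [ t / x ] = concatMap (substSymbol t x) s

-- Argument lists are arbitrary strings here; `Over 𝓛` below restricts them to
-- the lists of a system.  A predicate symbol has no fixed arity: `pred₀` uses
-- it with no arguments and `pred` with suc n ≥ 1 of them.

infix  7 _≐_
infixr 6 ¬̇_
infixr 5 _∧̇_ _∨̇_
infixr 4 _→̇_ _↔̇_

data Formula (A P : Set ℓ) : Set ℓ where
  _≐_                 : Str A → Str A → Formula A P
  pred₀               : P → Formula A P
  pred                : P → ∀ {n} → Vec (Str A) (suc n) → Formula A P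
  ¬̇_                  : Formula A P → Formula A P
  _→̇_ _↔̇_ _∧̇_ _∨̇_     : Formula A P → Formula A P → Formula A P
  ∀̇ ∃̇                 : Var → Formula A P → Formula A P

Over : {A P : Set ℓ} → Pred (Str A) ℓ → Formula A P → Set ℓ
Over Q (s ≐ t)     = Q s × Q t
Over Q (pred₀ p)   = ⊤
Over Q (pred p ts) = All Q ts
Over Q (¬̇ F)       = Over Q F
Over Q (F →̇ G)     = Over Q F × Over Q G
Over Q (F ↔̇ G)     = Over Q F × Over Q G
Over Q (F ∧̇ G)     = Over Q F × Over Q G
Over Q (F ∨̇ G)     = Over Q F × Over Q G
Over Q (∀̇ x F)     = Over Q F
Over Q (∃̇ x F)     = Over Q F

_∈free_ : {A P : Set ℓ} → Var → Formula A P → Set ℓ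
x ∈free (s ≐ t)     = x ∈var s ⊎ x ∈var t
x ∈free (pred₀ p)   = ⊥
x ∈free (pred p ts) = Any (x ∈var_) ts
x ∈free (¬̇ F)       = x ∈free F
x ∈free (F →̇ G)     = x ∈free F ⊎ x ∈free G
x ∈free (F ↔̇ G)     = x ∈free F ⊎ x ∈free G
x ∈free (F ∧̇ G)     = x ∈free F ⊎ x ∈free G
x ∈free (F ∨̇ G)     = x ∈free F ⊎ x ∈free G
x ∈free (∀̇ y F)     = x ≢ y × x ∈free F
x ∈free (∃̇ y F)     = x ≢ y × x ∈free F

SbF : {A P : Set ℓ} → Formula A P → Str A → Var → Formula A P
SbF (r ≐ s)     t x = (r [ t / x ]) ≐ (s [ t / x ])
SbF (pred₀ p)   t x = pred₀ p
SbF (pred p ts) t x = pred p (Vec.map _[ t / x ] ts)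
SbF (¬̇ F)       t x = ¬̇ SbF F t x
SbF (F →̇ G)     t x = SbF F t x →̇ SbF G t x
SbF (F ↔̇ G)     t x = SbF F t x ↔̇ SbF G t x
SbF (F ∧̇ G)     t x = SbF F t x ∧̇ SbF G t x
SbF (F ∨̇ G)     t x = SbF F t x ∨̇ SbF G t x
SbF (∀̇ y F)     t x = if does (y ≟ x) then ∀̇ y F else ∀̇ y (SbF F t x)
SbF (∃̇ y F)     t x = if does (y ≟ x) then ∃̇ y F else ∃̇ y (SbF F t x)

-- Collision-freeness.  In ∀̇ x F and ∃̇ x F there is no free occurrence of x, so
-- nothing is required there.

CF : {A P : Set ℓ} → Formula A P → Str A → Var → Set ℓ
CF (r ≐ s)     t x = ⊤
CF (pred₀ p)   t x = ⊤
CF (pred p ts) t x = ⊤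
CF (¬̇ F)       t x = CF F t x
CF (F →̇ G)     t x = CF F t x × CF G t x
CF (F ↔̇ G)     t x = CF F t x × CF G t x
CF (F ∧̇ G)     t x = CF F t x × CF G t x
CF (F ∨̇ G)     t x = CF F t x × CF G t x
CF (∀̇ y F)     t x = x ≢ y → CF F t x × (x ∈free F → ¬ (y ∈var t))
CF (∃̇ y F)     t x = x ≢ y → CF F t x × (x ∈free F → ¬ (y ∈var t))

infixr 4 _→ᵇ_ _↔ᵇ_

_→ᵇ_ _↔ᵇ_ : Bool → Bool → Bool
a →ᵇ b = not a ∨ b
a ↔ᵇ b = (a →ᵇ b) ∧ (b →ᵇ a)

data PropForm (j : ℕ) : Set where
  atom                : Fin j → PropForm j
  neg                 : PropForm j → PropForm j
  imp iff conj disj   : PropForm j → PropForm j → PropForm j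

eval : ∀ {j} → (Fin j → Bool) → PropForm j → Bool
eval v (atom i)   = v i
eval v (neg a)    = not (eval v a)
eval v (imp a b)  = eval v a →ᵇ eval v b
eval v (iff a b)  = eval v a ↔ᵇ eval v b
eval v (conj a b) = eval v a ∧ eval v b
eval v (disj a b) = eval v a ∨ eval v b

Tautology : ∀ {j} → PropForm j → Set
Tautology α = ∀ v → eval v α ≡ true

instantiate : {A P : Set ℓ} → ∀ {j} → PropForm j → (Fin j → Formula A P) → Formula A P
instantiate (atom i)   F = F i
instantiate (neg a)    F = ¬̇ instantiate a F
instantiate (imp a b)  F = instantiate a F →̇ instantiate b F
instantiate (iff a b)  F = instantiate a F ↔̇ instantiate b F
instantiate (conj a b) F = instantiate a F ∧̇ instantiate b F
instantiate (disj a b) F = instantiate a F ∨̇ instantiate b F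

record System (ℓ : Level) : Set (lsuc ℓ) where
  field
    A P     : Set ℓ
    𝓛       : Pred (Str A) ℓ
    𝓛-alist : ∀ {s} → 𝓛 s → IsAList s
    𝓛-var   : ∀ x → 𝓛 ⟪ x ⟫
    𝓛-subst : ∀ {s t} x → 𝓛 s → 𝓛 t → 𝓛 (s [ t / x ])
    B       : Pred (Formula A P) ℓ
    B-over  : ∀ {F} → B F → Over 𝓛 F

-- equations (x₁ ∷ …) (y₁ ∷ …) F is  → ∼x₁,y₁ … → ∼xₙ,yₙ F.

equations : {A P : Set ℓ} → ∀ {n} → Vec Var n → Vec Var n → Formula A P → Formula A P
equations []       []       F = F
equations (x ∷ xs) (y ∷ ys) F = ⟪ x ⟫ ≐ ⟪ y ⟫ →̇ equations xs ys F

module _ (S : System ℓ) where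
  open System S

  data Provable : Formula A P → Set ℓ where
    basis      : ∀ {F} → B F → Provable F
    tautology  : ∀ {j} (α : PropForm j) → Tautology α →
                 (F : Fin j → Formula A P) → (∀ i → Over 𝓛 (F i)) →
                 Provable (instantiate α F)
    ≐-refl     : ∀ x → Provable (⟪ x ⟫ ≐ ⟪ x ⟫)
    ≐-subst    : ∀ x y {s t} → 𝓛 s → 𝓛 t →
                 Provable (SbF (s ≐ t) ⟪ x ⟫ y →̇ ⟪ x ⟫ ≐ ⟪ y ⟫ →̇ s ≐ t)
    ≐-pred     : ∀ p {n} (xs ys : Vec Var (suc n)) →
                 Provable (equations xs ys
                   (pred p (Vec.map ⟪_⟫ xs) →̇ pred p (Vec.map ⟪_⟫ ys)))
    ∀-elim     : ∀ x {F} → Over 𝓛 F → Provable (∀̇ x F →̇ F)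
    ∀-distrib  : ∀ x {F G} → Over 𝓛 F → Over 𝓛 G → ¬ (x ∈free F) →
                 Provable (∀̇ x (F →̇ G) →̇ F →̇ ∀̇ x G)
    ∃-def      : ∀ x {F} → Over 𝓛 F → Provable (¬̇ ∀̇ x (¬̇ F) ↔̇ ∃̇ x F)
    mp         : ∀ {F G} → Provable F → Provable (F →̇ G) → Provable G
    subst-rule : ∀ {F} x {t} → 𝓛 t → CF F t x → Provable F → Provable (SbF F t x)
    gen        : ∀ {F} x → Provable F → Provable (∀̇ x F)

  Contradictory : Set ℓ
  Contradictory = ∀ F → Over 𝓛 F → Provable F

  Consistent : Set ℓ
  Consistent = ¬ Contradictory

mapSymbol : {A N : Set ℓ} → (A → N) → Symbol A → Symbol N
mapSymbol f (var x) = var x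
mapSymbol f (op a)  = op (f a)
mapSymbol f lpar    = lpar
mapSymbol f rpar    = rpar

mapStr : {A N : Set ℓ} → (A → N) → Str A → Str N
mapStr f = List.map (mapSymbol f)

mapFormula : {A N P : Set ℓ} → (A → N) → Formula A P → Formula N P
mapFormula f (s ≐ t)     = mapStr f s ≐ mapStr f t
mapFormula f (pred₀ p)   = pred₀ p
mapFormula f (pred p ts) = pred p (Vec.map (mapStr f) ts)
mapFormula f (¬̇ F)       = ¬̇ mapFormula f F
mapFormula f (F →̇ G)     = mapFormula f F →̇ mapFormula f G
mapFormula f (F ↔̇ G)     = mapFormula f F ↔̇ mapFormula f G
mapFormula f (F ∧̇ G)     = mapFormula f F ∧̇ mapFormula f G
mapFormula f (F ∨̇ G)     = mapFormula f F ∨̇ mapFormula f G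
mapFormula f (∀̇ x F)     = ∀̇ x (mapFormula f F)
mapFormula f (∃̇ x F)     = ∃̇ x (mapFormula f F)

name : {A N : Set ℓ} → N → Str (A ⊎ N)
name κ = op (inj₂ κ) ∷ []

-- Instance 𝓛 m s: s is  l [κ₁/x₁] … [κₘ/xₘ]  with l in 𝓛 and names κᵢ.

data Instance {A N : Set ℓ} (𝓛 : Pred (Str A) ℓ) : ℕ → Str (A ⊎ N) → Set ℓ where
  base : ∀ {l} → 𝓛 l → Instance 𝓛 zero (mapStr inj₁ l)
  step : ∀ {m s} (κ : N) x → Instance 𝓛 m s → Instance 𝓛 (suc m) (s [ name κ / x ])

-- The extended system is again a system: its lists are closed under
-- substitution, because a variable about to be replaced by a name can first
-- be renamed to a fresh one.

hit : ∀ (t : Str T) x → ⟪ x ⟫ [ t / x ] ≡ t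
hit t x rewrite dec-true (x ≟ x) refl = ++-[] t
  where
  ++-[] : ∀ {B : Set ℓ} (xs : List B) → xs ++ [] ≡ xs
  ++-[] []       = refl
  ++-[] (x ∷ xs) = cong (x ∷_) (++-[] xs)

miss : ∀ (t : Str T) {x y} → y ≢ x → ⟪ y ⟫ [ t / x ] ≡ ⟪ y ⟫
miss t {x} {y} y≢x rewrite dec-false (y ≟ x) y≢x = refl

subst-++ : ∀ (r s t : Str T) x → (r ++ s) [ t / x ] ≡ r [ t / x ] ++ s [ t / x ]
subst-++ r s t x = concatMap-++ (substSymbol t x) r s

subst-idle : ∀ (s t : Str T) x → ¬ (x ∈var s) → s [ t / x ] ≡ s
subst-idle []           t x x∉s = refl
subst-idle (var y ∷ s)  t x x∉s = trans (subst-++ ⟪ y ⟫ s t x)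
  (cong₂ _++_ (miss t λ { refl → x∉s (here refl) }) (subst-idle s t x (x∉s ∘ there)))
subst-idle (op a ∷ s)   t x x∉s = cong (op a ∷_) (subst-idle s t x (x∉s ∘ there))
subst-idle (lpar ∷ s)   t x x∉s = cong (lpar ∷_) (subst-idle s t x (x∉s ∘ there))
subst-idle (rpar ∷ s)   t x x∉s = cong (rpar ∷_) (subst-idle s t x (x∉s ∘ there))

subst-∈⁻ : ∀ (s t : Str T) x {y} → y ∈var (s [ t / x ]) → y ∈var t ⊎ (y ∈var s × y ≢ x)
subst-∈⁻ (var z ∷ s) t x y∈
  with ∈-++⁻ (⟪ z ⟫ [ t / x ]) (subst (_ ∈_) (subst-++ ⟪ z ⟫ s t x) y∈)
... | inj₂ y∈s with subst-∈⁻ s t x y∈s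
...   | inj₁ y∈t       = inj₁ y∈t
...   | inj₂ (p , y≢x) = inj₂ (there p , y≢x)
subst-∈⁻ (var z ∷ s) t x y∈ | inj₁ y∈z with z ≟ x
... | yes refl = inj₁ (subst (_ ∈_) (hit t x) y∈z)
... | no  z≢x  with subst (_ ∈_) (miss t z≢x) y∈z
...   | here refl = inj₂ (here refl , z≢x)
subst-∈⁻ (op a ∷ s) t x (there y∈) with subst-∈⁻ s t x y∈
... | inj₁ y∈t       = inj₁ y∈t
... | inj₂ (p , y≢x) = inj₂ (there p , y≢x)
subst-∈⁻ (lpar ∷ s) t x (there y∈) with subst-∈⁻ s t x y∈
... | inj₁ y∈t       = inj₁ y∈t
... | inj₂ (p , y≢x) = inj₂ (there p , y≢x)
subst-∈⁻ (rpar ∷ s) t x (there y∈) with subst-∈⁻ s t x y∈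
... | inj₁ y∈t       = inj₁ y∈t
... | inj₂ (p , y≢x) = inj₂ (there p , y≢x)

IsAList-map : {A N : Set ℓ} (f : A → N) → ∀ {s} → IsAList s → IsAList (mapStr f s)
IsAList-map f (var x)             = var x
IsAList-map f (op a)              = op (f a)
IsAList-map f (app g {s} p)
  rewrite map-++ (mapSymbol f) s (rpar ∷ []) = app (f g) (IsAList-map f p)
IsAList-map f (cat {s} {t} p q)
  rewrite map-++ (mapSymbol f) s t = cat (IsAList-map f p) (IsAList-map f q)

IsAList-subst : ∀ {s t : Str T} x → IsAList s → IsAList t → IsAList (s [ t / x ])
IsAList-subst {t = t} x (var y) q with y ≟ x
... | yes refl = subst IsAList (sym (hit t x)) q
... | no  y≢x  = subst IsAList (sym (miss t y≢x)) (var y)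
IsAList-subst x (op a) q = op a
IsAList-subst {t = t} x (app f {s} p) q
  rewrite subst-++ s (rpar ∷ []) t x = app f (IsAList-subst x p q)
IsAList-subst {t = u} x (cat {s} {t} p p′) q
  rewrite subst-++ s t u x = cat (IsAList-subst x p q) (IsAList-subst x p′ q)

mapStr-subst : {A N : Set ℓ} (f : A → N) (s t : Str A) (x : Var) →
               mapStr f s [ mapStr f t / x ] ≡ mapStr f (s [ t / x ])
mapStr-subst f []          t x = refl
mapStr-subst f (var y ∷ s) t x = begin
  mapStr f (var y ∷ s) [ t′ / x ]                     ≡⟨ subst-++ ⟪ y ⟫ (mapStr f s) t′ x ⟩
  ⟪ y ⟫ [ t′ / x ] ++ mapStr f s [ t′ / x ]           ≡⟨ cong₂ _++_ variable-case (mapStr-subst f s t x) ⟩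
  mapStr f (⟪ y ⟫ [ t / x ]) ++ mapStr f (s [ t / x ]) ≡⟨ map-++ (mapSymbol f) (⟪ y ⟫ [ t / x ]) (s [ t / x ]) ⟨
  mapStr f (⟪ y ⟫ [ t / x ] ++ s [ t / x ])           ≡⟨ cong (mapStr f) (subst-++ ⟪ y ⟫ s t x) ⟨
  mapStr f ((var y ∷ s) [ t / x ])                    ∎
  where
  open ≡-Reasoning
  t′ = mapStr f t
  variable-case : ⟪ y ⟫ [ t′ / x ] ≡ mapStr f (⟪ y ⟫ [ t / x ])
  variable-case with y ≟ x
  ... | yes refl = trans (hit t′ x) (cong (mapStr f) (sym (hit t x)))
  ... | no  y≢x  = trans (miss t′ y≢x) (cong (mapStr f) (sym (miss t y≢x)))
mapStr-subst f (op a ∷ s)  t x = cong (op (f a) ∷_) (mapStr-subst f s t x)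
mapStr-subst f (lpar ∷ s)  t x = cong (lpar ∷_) (mapStr-subst f s t x)
mapStr-subst f (rpar ∷ s)  t x = cong (rpar ∷_) (mapStr-subst f s t x)

fresh : Str T → Var
fresh []          = zero
fresh (var x ∷ s) = suc x ⊔ fresh s
fresh (op _ ∷ s)  = fresh s
fresh (lpar ∷ s)  = fresh s
fresh (rpar ∷ s)  = fresh s

∈⇒<fresh : ∀ (s : Str T) {x} → x ∈var s → x < fresh s
∈⇒<fresh (var x ∷ s) (here refl) = m≤m⊔n (suc x) (fresh s)
∈⇒<fresh (var x ∷ s) (there p)   = <-≤-trans (∈⇒<fresh s p) (m≤n⊔m (suc x) (fresh s))
∈⇒<fresh (op _ ∷ s)  (there p)   = ∈⇒<fresh s p
∈⇒<fresh (lpar ∷ s)  (there p)   = ∈⇒<fresh s p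
∈⇒<fresh (rpar ∷ s)  (there p)   = ∈⇒<fresh s p

fresh-∉ : ∀ (s : Str T) → ¬ (fresh s ∈var s)
fresh-∉ s p = <-irrefl refl (∈⇒<fresh s p)

rename-fresh : ∀ (s t : Str T) {w} z → ¬ (z ∈var s) → s [ t / w ] ≡ s [ ⟪ z ⟫ / w ] [ t / z ]
rename-fresh []          t {w} z z∉ = refl
rename-fresh (var v ∷ s) t {w} z z∉ = begin
  (var v ∷ s) [ t / w ]                                   ≡⟨ subst-++ ⟪ v ⟫ s t w ⟩
  ⟪ v ⟫ [ t / w ] ++ s [ t / w ]                          ≡⟨ cong₂ _++_ variable-case (rename-fresh s t z (z∉ ∘ there)) ⟩
  ⟪ v ⟫ [ ⟪ z ⟫ / w ] [ t / z ] ++ s [ ⟪ z ⟫ / w ] [ t / z ] ≡⟨ subst-++ (⟪ v ⟫ [ ⟪ z ⟫ / w ]) _ t z ⟨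
  (⟪ v ⟫ [ ⟪ z ⟫ / w ] ++ s [ ⟪ z ⟫ / w ]) [ t / z ]      ≡⟨ cong _[ t / z ] (subst-++ ⟪ v ⟫ s ⟪ z ⟫ w) ⟨
  (var v ∷ s) [ ⟪ z ⟫ / w ] [ t / z ]                     ∎
  where
  open ≡-Reasoning
  variable-case : ⟪ v ⟫ [ t / w ] ≡ ⟪ v ⟫ [ ⟪ z ⟫ / w ] [ t / z ]
  variable-case with v ≟ w
  ... | yes refl = trans (hit t v) (sym (trans (cong _[ t / z ] (hit ⟪ z ⟫ v)) (hit t z)))
  ... | no  v≢w  = trans (miss t v≢w) (sym (trans (cong _[ t / z ] (miss ⟪ z ⟫ v≢w))
                     (miss t λ { refl → z∉ (here refl) })))
rename-fresh (op a ∷ s)  t z z∉ = cong (op a ∷_) (rename-fresh s t z (z∉ ∘ there))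
rename-fresh (lpar ∷ s)  t z z∉ = cong (lpar ∷_) (rename-fresh s t z (z∉ ∘ there))
rename-fresh (rpar ∷ s)  t z z∉ = cong (rpar ∷_) (rename-fresh s t z (z∉ ∘ there))

-- Substitutions commute when the variables differ, z does not occur in t, and
-- r is closed.

subst-comm : ∀ (s r t : Str T) {x z} → x ≢ z → (∀ y → ¬ (y ∈var r)) → ¬ (z ∈var t) →
             s [ r / z ] [ t / x ] ≡ s [ t / x ] [ r / z ]
subst-comm []          r t x≢z r-closed z∉t = refl
subst-comm (var v ∷ s) r t {x} {z} x≢z r-closed z∉t = begin
  (var v ∷ s) [ r / z ] [ t / x ]                       ≡⟨ cong _[ t / x ] (subst-++ ⟪ v ⟫ s r z) ⟩
  (⟪ v ⟫ [ r / z ] ++ s [ r / z ]) [ t / x ]            ≡⟨ subst-++ (⟪ v ⟫ [ r / z ]) _ t x ⟩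
  ⟪ v ⟫ [ r / z ] [ t / x ] ++ s [ r / z ] [ t / x ]    ≡⟨ cong₂ _++_ variable-case (subst-comm s r t x≢z r-closed z∉t) ⟩
  ⟪ v ⟫ [ t / x ] [ r / z ] ++ s [ t / x ] [ r / z ]    ≡⟨ subst-++ (⟪ v ⟫ [ t / x ]) _ r z ⟨
  (⟪ v ⟫ [ t / x ] ++ s [ t / x ]) [ r / z ]            ≡⟨ cong _[ r / z ] (subst-++ ⟪ v ⟫ s t x) ⟨
  (var v ∷ s) [ t / x ] [ r / z ]                       ∎
  where
  open ≡-Reasoning
  variable-case : ⟪ v ⟫ [ r / z ] [ t / x ] ≡ ⟪ v ⟫ [ t / x ] [ r / z ]
  variable-case with v ≟ z | v ≟ x
  ... | yes refl | yes refl = contradiction refl x≢z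
  ... | yes refl | no  v≢x  =
    trans (cong _[ t / x ] (hit r v))
      (trans (subst-idle r t x (r-closed x))
        (sym (trans (cong _[ r / v ] (miss t v≢x)) (hit r v))))
  ... | no  v≢z  | yes refl =
    trans (cong _[ t / v ] (miss r v≢z))
      (trans (hit t v)
        (sym (trans (cong _[ r / z ] (hit t v)) (subst-idle t r z z∉t))))
  ... | no  v≢z  | no  v≢x  =
    trans (cong _[ t / x ] (miss r v≢z))
      (trans (miss t v≢x)
        (sym (trans (cong _[ r / z ] (miss t v≢x)) (miss r v≢z))))
subst-comm (op a ∷ s)  r t x≢z r-closed z∉t = cong (op a ∷_) (subst-comm s r t x≢z r-closed z∉t)
subst-comm (lpar ∷ s)  r t x≢z r-closed z∉t = cong (lpar ∷_) (subst-comm s r t x≢z r-closed z∉t)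
subst-comm (rpar ∷ s)  r t x≢z r-closed z∉t = cong (rpar ∷_) (subst-comm s r t x≢z r-closed z∉t)

subst-nested : ∀ (s t r : Str T) x z → ¬ (z ∈var s) →
              s [ t [ r / z ] / x ] ≡ s [ t / x ] [ r / z ]
subst-nested []          t r x z z∉ = refl
subst-nested (var v ∷ s) t r x z z∉ = begin
  (var v ∷ s) [ t [ r / z ] / x ]                       ≡⟨ subst-++ ⟪ v ⟫ s (t [ r / z ]) x ⟩
  ⟪ v ⟫ [ t [ r / z ] / x ] ++ s [ t [ r / z ] / x ]    ≡⟨ cong₂ _++_ variable-case (subst-nested s t r x z (z∉ ∘ there)) ⟩
  ⟪ v ⟫ [ t / x ] [ r / z ] ++ s [ t / x ] [ r / z ]    ≡⟨ subst-++ (⟪ v ⟫ [ t / x ]) _ r z ⟨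
  (⟪ v ⟫ [ t / x ] ++ s [ t / x ]) [ r / z ]            ≡⟨ cong _[ r / z ] (subst-++ ⟪ v ⟫ s t x) ⟨
  (var v ∷ s) [ t / x ] [ r / z ]                       ∎
  where
  open ≡-Reasoning
  variable-case : ⟪ v ⟫ [ t [ r / z ] / x ] ≡ ⟪ v ⟫ [ t / x ] [ r / z ]
  variable-case with v ≟ x
  ... | yes refl = trans (hit (t [ r / z ]) v) (cong _[ r / z ] (sym (hit t v)))
  ... | no  v≢x  = trans (miss (t [ r / z ]) v≢x) (sym (trans (cong _[ r / z ] (miss t v≢x))
                     (miss r λ { refl → z∉ (here refl) })))
subst-nested (op a ∷ s)  t r x z z∉ = cong (op a ∷_) (subst-nested s t r x z (z∉ ∘ there))
subst-nested (lpar ∷ s)  t r x z z∉ = cong (lpar ∷_) (subst-nested s t r x z (z∉ ∘ there))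
subst-nested (rpar ∷ s)  t r x z z∉ = cong (rpar ∷_) (subst-nested s t r x z (z∉ ∘ there))

name-closed : {A N : Set ℓ} (κ : N) → ∀ y → ¬ (y ∈var name {A = A} κ)
name-closed κ y (here ())
name-closed κ y (there ())

Over-map : {A N P : Set ℓ} {Q : Pred (Str A) ℓ} {R : Pred (Str N) ℓ} (f : A → N) →
           (∀ {s} → Q s → R (mapStr f s)) →
           (F : Formula A P) → Over Q F → Over R (mapFormula f F)
Over-map f h (s ≐ t)     (p , q) = h p , h q
Over-map f h (pred₀ p)   _       = tt
Over-map f h (pred p ts) ps      = All.map⁺ (All.map h ps)
Over-map f h (¬̇ F)       p       = Over-map f h F p
Over-map f h (F →̇ G)     (p , q) = Over-map f h F p , Over-map f h G q
Over-map f h (F ↔̇ G)     (p , q) = Over-map f h F p , Over-map f h G q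
Over-map f h (F ∧̇ G)     (p , q) = Over-map f h F p , Over-map f h G q
Over-map f h (F ∨̇ G)     (p , q) = Over-map f h F p , Over-map f h G q
Over-map f h (∀̇ x F)     p       = Over-map f h F p
Over-map f h (∃̇ x F)     p       = Over-map f h F p

module _ (S : System ℓ) (N : Set ℓ) where
  open System S

  private
    Inst : ℕ → Str (A ⊎ N) → Set ℓ
    Inst = Instance 𝓛

  Inst-alist : ∀ {m s} → Inst m s → IsAList s
  Inst-alist (base l)     = IsAList-map inj₁ (𝓛-alist l)
  Inst-alist (step κ x p) = IsAList-subst x (Inst-alist p) (op (inj₂ κ))

  Inst-subst₀ : ∀ {m s t} x → Inst m s → 𝓛 t → Inst m (s [ mapStr inj₁ t / x ])
  Inst-subst₀ {t = t} x (base {l} p) q =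
    subst (Inst zero) (sym (mapStr-subst inj₁ l t x)) (base (𝓛-subst x p q))
  Inst-subst₀ {t = t} x (step {m} {s} κ w p) q =
    subst (Inst (suc m)) (sym eq)
      (step κ z (Inst-subst₀ x (Inst-subst₀ w p (𝓛-var z)) q))
    where
    t′ = mapStr inj₁ t
    z  = fresh (s ++ t′ ++ ⟪ x ⟫)
    z∉ = fresh-∉ (s ++ t′ ++ ⟪ x ⟫)
    eq : s [ name κ / w ] [ t′ / x ] ≡ s [ ⟪ z ⟫ / w ] [ t′ / x ] [ name κ / z ]
    eq = trans (cong _[ t′ / x ] (rename-fresh s (name κ) z (z∉ ∘ ∈-++⁺ˡ)))
      (subst-comm (s [ ⟪ z ⟫ / w ]) (name κ) t′
        (λ x≡z → z∉ (∈-++⁺ʳ s (∈-++⁺ʳ t′ (here (cong var (sym x≡z))))))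
        (name-closed κ) (z∉ ∘ ∈-++⁺ʳ s ∘ ∈-++⁺ˡ))

  Inst-subst : ∀ {m k s t} x → Inst m s → Inst k t → ∃ λ n → Inst n (s [ t / x ])
  Inst-subst {m} x p (base q) = m , Inst-subst₀ x p q
  Inst-subst {s = s} x p (step {s = t} κ w q)
    with Inst-subst x p (Inst-subst₀ w q (𝓛-var (fresh (s ++ t))))
  ... | n , r = suc n , subst (Inst (suc n)) (sym eq) (step κ z r)
    where
    z  = fresh (s ++ t)
    z∉ = fresh-∉ (s ++ t)
    eq : s [ t [ name κ / w ] / x ] ≡ s [ t [ ⟪ z ⟫ / w ] / x ] [ name κ / z ]
    eq = trans (cong (s [_/ x ]) (rename-fresh t (name κ) z (z∉ ∘ ∈-++⁺ʳ s)))
               (subst-nested s (t [ ⟪ z ⟫ / w ]) (name κ) x z (z∉ ∘ ∈-++⁺ˡ))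

  extend : System ℓ
  extend = record
    { A       = A ⊎ N
    ; P       = P
    ; 𝓛       = λ s → ∃ λ m → Inst m s
    ; 𝓛-alist = λ (_ , p) → Inst-alist p
    ; 𝓛-var   = λ x → zero , base (𝓛-var x)
    ; 𝓛-subst = λ x (_ , p) (_ , q) → Inst-subst x p q
    ; B       = λ F̂ → ∃ λ F → B F × F̂ ≡ mapFormula inj₁ F
    ; B-over  = λ { (F , F∈B , refl) → Over-map inj₁ (λ p → zero , base p) F (B-over F∈B) }
    }

Over-SbF : {A P : Set ℓ} {Q : Pred (Str A) ℓ} → ∀ {t} x →
           (∀ {s} → Q s → Q (s [ t / x ])) →
           (F : Formula A P) → Over Q F → Over Q (SbF F t x)
Over-SbF x h (r ≐ s)     (p , q) = h p , h q
Over-SbF x h (pred₀ p)   _       = tt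
Over-SbF x h (pred p ts) ps      = All.map⁺ (All.map h ps)
Over-SbF x h (¬̇ F)       p       = Over-SbF x h F p
Over-SbF x h (F →̇ G)     (p , q) = Over-SbF x h F p , Over-SbF x h G q
Over-SbF x h (F ↔̇ G)     (p , q) = Over-SbF x h F p , Over-SbF x h G q
Over-SbF x h (F ∧̇ G)     (p , q) = Over-SbF x h F p , Over-SbF x h G q
Over-SbF x h (F ∨̇ G)     (p , q) = Over-SbF x h F p , Over-SbF x h G q
Over-SbF x h (∀̇ y F)     p with does (y ≟ x)
... | true  = p
... | false = Over-SbF x h F p
Over-SbF x h (∃̇ y F)     p with does (y ≟ x)
... | true  = p
... | false = Over-SbF x h F p

free-SbF : {A P : Set ℓ} {t : Str A} → ∀ x → (∀ y → ¬ (y ∈var t)) →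
           (F : Formula A P) → ∀ {y} → y ∈free SbF F t x → y ∈free F × y ≢ x
free-SbF {t = t} x c (r ≐ s) {y} (inj₁ p) with subst-∈⁻ r t x p
... | inj₁ q         = contradiction q (c y)
... | inj₂ (q , y≢x) = inj₁ q , y≢x
free-SbF {t = t} x c (r ≐ s) {y} (inj₂ p) with subst-∈⁻ s t x p
... | inj₁ q         = contradiction q (c y)
... | inj₂ (q , y≢x) = inj₂ q , y≢x
free-SbF {t = t} x c (pred p ts) {y} q = go ts (Any.map⁻ q)
  where
  go : ∀ {n} (ts : Vec (Str _) n) → Any (λ s → y ∈var (s [ t / x ])) ts →
       Any (y ∈var_) ts × y ≢ x
  go (s ∷ ts) (Any.here p) with subst-∈⁻ s t x p
  ... | inj₁ r         = contradiction r (c y)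
  ... | inj₂ (r , y≢x) = Any.here r , y≢x
  go (s ∷ ts) (Any.there p) with go ts p
  ... | r , y≢x = Any.there r , y≢x
free-SbF x c (¬̇ F) p = free-SbF x c F p
free-SbF x c (F →̇ G) (inj₁ p) with free-SbF x c F p
... | q , y≢x = inj₁ q , y≢x
free-SbF x c (F →̇ G) (inj₂ p) with free-SbF x c G p
... | q , y≢x = inj₂ q , y≢x
free-SbF x c (F ↔̇ G) (inj₁ p) with free-SbF x c F p
... | q , y≢x = inj₁ q , y≢x
free-SbF x c (F ↔̇ G) (inj₂ p) with free-SbF x c G p
... | q , y≢x = inj₂ q , y≢x
free-SbF x c (F ∧̇ G) (inj₁ p) with free-SbF x c F p
... | q , y≢x = inj₁ q , y≢x
free-SbF x c (F ∧̇ G) (inj₂ p) with free-SbF x c G p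
... | q , y≢x = inj₂ q , y≢x
free-SbF x c (F ∨̇ G) (inj₁ p) with free-SbF x c F p
... | q , y≢x = inj₁ q , y≢x
free-SbF x c (F ∨̇ G) (inj₂ p) with free-SbF x c G p
... | q , y≢x = inj₂ q , y≢x
free-SbF x c (∀̇ z F) p with z ≟ x
... | yes refl rewrite dec-true (x ≟ x) refl = p , proj₁ p
... | no  z≢x  rewrite dec-false (z ≟ x) z≢x with free-SbF x c F (proj₂ p)
...   | q , y≢x = (proj₁ p , q) , y≢x
free-SbF x c (∃̇ z F) p with z ≟ x
... | yes refl rewrite dec-true (x ≟ x) refl = p , proj₁ p
... | no  z≢x  rewrite dec-false (z ≟ x) z≢x with free-SbF x c F (proj₂ p)
...   | q , y≢x = (proj₁ p , q) , y≢x

module _ {a} {A : Set a} where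

  drop-head : ∀ {x y : A} {xs} → y ∈ x ∷ xs → y ≢ x → y ∈ xs
  drop-head (here y≡x) y≢x = contradiction y≡x y≢x
  drop-head (there p)  _   = p

  ∉[] : ∀ {x : A} → x ∉ []
  ∉[] ()

module Closed (S : System ℓ) where
  open System S

  -- ListIn xs and FormulaIn xs consist of the lists / formulas of the system
  -- whose (free) variables are all among xs.  The membership proof is
  -- irrelevant, so a function on them depends on the list or formula only.

  ListIn : List Var → Set ℓ
  ListIn xs = [ s ∈ Str A ∣ 𝓛 s × (∀ y → y ∈var s → y ∈ xs) ]

  FormulaIn : List Var → Set ℓ
  FormulaIn xs = [ F ∈ Formula A P ∣ Over 𝓛 F × (∀ y → y ∈free F → y ∈ xs) ]

  ClosedList : Set ℓ
  ClosedList = ListIn []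

  Sentence : Set ℓ
  Sentence = FormulaIn []

  substList : ∀ {x xs} → ListIn (x ∷ xs) → ClosedList → ListIn xs
  substList {x} (s , [ p ]) (t , [ q ]) = s [ t / x ] ,
    [ (𝓛-subst x (proj₁ p) (proj₁ q) , λ y y∈ → lemma (proj₂ p) (proj₂ q) y∈) ]
    where
    lemma : ∀ {xs y} → (∀ y → y ∈var s → y ∈ x ∷ xs) → (∀ y → y ∈var t → y ∈ []) →
            y ∈var (s [ t / x ]) → y ∈ xs
    lemma p q y∈ with subst-∈⁻ s t x y∈
    ... | inj₁ y∈t         = contradiction (q _ y∈t) ∉[]
    ... | inj₂ (y∈s , y≢x) = drop-head (p _ y∈s) y≢x

  substFormula : ∀ {x xs} → FormulaIn (x ∷ xs) → ClosedList → FormulaIn xs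
  substFormula {x} (F , [ p ]) (t , [ q ]) = SbF F t x ,
    [ (Over-SbF x (λ r → 𝓛-subst x r (proj₁ q)) F (proj₁ p) ,
       λ y y∈ → lemma (proj₂ p) (proj₂ q) y∈) ]
    where
    lemma : ∀ {xs y} → (∀ y → y ∈free F → y ∈ x ∷ xs) → (∀ y → y ∈var t → y ∈ []) →
            y ∈free SbF F t x → y ∈ xs
    lemma p q y∈ with free-SbF x (λ y r → ∉[] (q y r)) F y∈
    ... | y∈F , y≢x = drop-head (p _ y∈F) y≢x

  -- F [l₁/x₁] … [lₘ/xₘ]

  closeOff : (bs : List (Var × ClosedList)) → FormulaIn (List.map proj₁ bs) → Sentence
  closeOff []             F = F
  closeOff ((x , l) ∷ bs) F = closeOff bs (substFormula F l)

  infix  7 _≐ˢ_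
  infixr 6 ¬ˢ_
  infixr 5 _∧ˢ_ _∨ˢ_
  infixr 4 _→ˢ_ _↔ˢ_

  _≐ˢ_ : ClosedList → ClosedList → Sentence
  (s , [ p ]) ≐ˢ (t , [ q ]) = s ≐ t ,
    [ ((proj₁ p , proj₁ q) , λ { y (inj₁ r) → proj₂ p y r ; y (inj₂ r) → proj₂ q y r }) ]

  pred₀ˢ : P → Sentence
  pred₀ˢ p = pred₀ p , [ (tt , λ _ ()) ]

  predˢ : P → ∀ {n} → Vec ClosedList (suc n) → Sentence
  predˢ p ls = pred p (Vec.map value ls) , membership ls
    where
    membership : ∀ {n} (ls : Vec ClosedList n) →
                 Irrelevant (All 𝓛 (Vec.map value ls) ×
                             (∀ y → Any (y ∈var_) (Vec.map value ls) → y ∈ []))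
    membership []               = [ ([] , λ _ ()) ]
    membership ((s , [ q ]) ∷ ls) with membership ls
    ... | [ r ] = [ (proj₁ q ∷ proj₁ r ,
                     λ { y (Any.here v) → proj₂ q y v ; y (Any.there v) → proj₂ r y v }) ]

  ¬ˢ_ : Sentence → Sentence
  ¬ˢ (F , p) = ¬̇ F , p

  binary : (_∙_ : Formula A P → Formula A P → Formula A P) →
           (∀ {F G} → Over 𝓛 F × Over 𝓛 G → Over 𝓛 (F ∙ G)) →
           (∀ {F G y} → y ∈free (F ∙ G) → y ∈free F ⊎ y ∈free G) →
           Sentence → Sentence → Sentence
  binary _∙_ over free (F , [ p ]) (G , [ q ]) = F ∙ G ,
    [ (over (proj₁ p , proj₁ q) , λ y r → split (proj₂ p y) (proj₂ q y) (free r)) ]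
    where
    split : ∀ {y} → (y ∈free F → y ∈ []) → (y ∈free G → y ∈ []) →
            y ∈free F ⊎ y ∈free G → y ∈ []
    split f g (inj₁ r) = f r
    split f g (inj₂ r) = g r

  _→ˢ_ _↔ˢ_ _∧ˢ_ _∨ˢ_ : Sentence → Sentence → Sentence
  _→ˢ_ = binary _→̇_ (λ p → p) (λ p → p)
  _↔ˢ_ = binary _↔̇_ (λ p → p) (λ p → p)
  _∧ˢ_ = binary _∧̇_ (λ p → p) (λ p → p)
  _∨ˢ_ = binary _∨̇_ (λ p → p) (λ p → p)

  ∀ˢ ∃ˢ : ∀ x → FormulaIn (x ∷ []) → Sentence
  ∀ˢ x (F , [ p ]) = ∀̇ x F , [ (proj₁ p , λ y (y≢x , r) → drop-head (proj₂ p y r) y≢x) ]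
  ∃ˢ x (F , [ p ]) = ∃̇ x F , [ (proj₁ p , λ y (y≢x , r) → drop-head (proj₂ p y r) y≢x) ]

record Model (S : System ℓ) : Set (lsuc ℓ) where
  open System S using (P)

  -- Names are the new symbols inj₂ (α d) of Â = A ⊎ Name; surjectivity of α
  -- says that every name names an individual.

  field
    U           : Set ℓ
    inhabitant  : U
    Name        : Set ℓ
    α           : U → Name
    α-bijective : Bijective _≡_ _≡_ α

  Ŝ : System ℓ
  Ŝ = extend S Name

  open System Ŝ using () renaming (A to Â; 𝓛 to 𝓛̂; B to B̂; B-over to B̂-over)
  open Closed Ŝ

  nameOf : U → ClosedList
  nameOf d = name (α d) ,
    [ ((1 , subst (Instance _ 1) (hit (name (α d)) 0) (step (α d) 0 (base (System.𝓛-var S 0)))) ,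
       λ y r → contradiction r (name-closed (α d) y)) ]

  field
    ⟦_⟧           : ClosedList → U
    ⟦⟧-surjective : Surjective _≡_ _≡_ ⟦_⟧
    ⟦⟧-subst      : ∀ x (s : ListIn (x ∷ [])) (t : ClosedList) →
                    ⟦ substList s t ⟧ ≡ ⟦ substList s (nameOf ⟦ t ⟧) ⟧

    -- rel p n is the (n + 1)-ary predicate attached to p.

    rel₀ : P → Bool
    rel  : P → ∀ n → Pred (Vec U (suc n)) ℓ

    truth       : Sentence → Bool
    truth-≐     : ∀ s t → (truth (s ≐ˢ t) ≡ true) ⇔ (⟦ s ⟧ ≡ ⟦ t ⟧)
    truth-pred₀ : ∀ p → truth (pred₀ˢ p) ≡ rel₀ p
    truth-pred  : ∀ p {n} (ts : Vec ClosedList (suc n)) →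
                  (truth (predˢ p ts) ≡ true) ⇔ rel p n (Vec.map ⟦_⟧ ts)
    truth-¬     : ∀ F → truth (¬ˢ F) ≡ not (truth F)
    truth-→     : ∀ F G → truth (F →ˢ G) ≡ (truth F →ᵇ truth G)
    truth-↔     : ∀ F G → truth (F ↔ˢ G) ≡ (truth F ↔ᵇ truth G)
    truth-∧     : ∀ F G → truth (F ∧ˢ G) ≡ (truth F ∧ truth G)
    truth-∨     : ∀ F G → truth (F ∨ˢ G) ≡ (truth F ∨ truth G)
    truth-∀     : ∀ x (F : FormulaIn (x ∷ [])) →
                  (truth (∀ˢ x F) ≡ true) ⇔ (∀ l → truth (substFormula F l) ≡ true)
    truth-∃     : ∀ x (F : FormulaIn (x ∷ [])) →
                  (truth (∃ˢ x F) ≡ true) ⇔ (∃ λ l → truth (substFormula F l) ≡ true)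

  -- For every enumeration x₁,…,xₘ of free(F) without repetition and all closed
  -- lists l₁,…,lₘ, given together as bs = (x₁ , l₁) ∷ … ∷ (xₘ , lₘ) ∷ [].

  Valid : (F : Formula Â P) → .(Over 𝓛̂ F) → Set ℓ
  Valid F o = ∀ (bs : List (Var × ClosedList)) → Unique (List.map proj₁ bs) →
              (free : ∀ y → y ∈free F ⇔ y ∈ List.map proj₁ bs) →
              truth (closeOff bs (F , [ (o , λ y → Equivalence.to (free y)) ])) ≡ true

  field
    basis-valid : ∀ {F} (F∈B : B̂ F) → Valid F (B̂-over F∈B)

{-# OPTIONS --safe #-}
module Submission where

-- The calculus is sound: every provable formula is true in the model under
-- every assignment of closed lists to variables.  Since  ∼x,x  is provable, it
-- is true, so  ¬ ∼x,x  is false and hence not provable.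
--
-- An assignment σ turns a formula F into the sentence close σ F by replacing
-- all free variables simultaneously (inst), where the symbols of A are embedded
-- into the extended alphabet on the way.  Assigning closed lists of the extended
-- system rather than individuals keeps almost all of the argument syntactic:
--
--  * inst-SbF: if CF F t x, then F [t/x] under σ is literally the same sentence
--    as F under the assignment that maps x to t under σ.  This is the
--    substitution rule.
--  * substFormula-closeBut: replacing x by a closed list l in F closed under σ
--    except at x gives F closed under σ [ x ≔ l ], so the clauses of the model
--    for quantifiers become the usual ones for assignments.  This gives
--    generalization and the quantifier axioms.
--  * ⟦⟧-congruent: the value of s under σ does not change when the list assigned
--    to a variable is replaced by another one with the same value.  This gives
--    the equality axioms, and it is the only place that uses the compatibility of
--    ⟦_⟧ with names.
--  * closeOff-value: replacing the free variables one after the other by closed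
--    lists agrees with replacing them simultaneously, so a valid formula is true
--    under every assignment.  This gives the basis axioms.
--
-- Truth values are Booleans, so the tautologies and the axiom for ∃ need no
-- excluded middle.

open import Defs
open import Data.Empty using (⊥-elim-irr)
open import Data.Bool.Base using (true; false; not; _∧_; _∨_; if_then_else_)
open import Data.Bool.Properties using (¬-not)
open import Data.Fin.Base using (Fin)
open import Data.Irrelevant using ([_])
open import Data.List.Base as List using (List; _∷_; []; _++_)
open import Data.List.Properties using (concatMap-++; ++-identityʳ; map-∘; map-id)
open import Data.List.Membership.Propositional using (_∈_)
open import Data.List.Membership.Propositional.Properties
  using (∈-++⁻; ∈-++⁺ˡ; ∈-++⁺ʳ; ∈-filter⁺; ∈-filter⁻; ∈-deduplicate⁺; ∈-deduplicate⁻)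
open import Data.List.Relation.Unary.Any using (here; there)
open import Data.List.Relation.Unary.Unique.Propositional using (Unique)
open import Data.List.Relation.Unary.Unique.DecPropositional.Properties using (deduplicate-!)
open import Data.Nat.Base using (ℕ; zero; suc; _<_)
open import Data.Nat.Properties using (_≟_; <-irrefl; m<n⇒m<1+n; n<1+n; m<1+n⇒m<n∨m≡n; _<?_)
open import Data.Product.Base using (∃; _×_; _,_; proj₁; proj₂)
open import Data.Refinement.Base using (Refinement; Refinement-syntax; value; _,_)
open import Data.Sum.Base using (_⊎_; inj₁; inj₂; [_,_]′)
open import Data.Unit.Polymorphic using (tt)
open import Data.Vec.Base as Vec using (Vec; _∷_; [])
import Data.Vec.Properties as Vec
open import Data.Vec.Relation.Unary.All as All using (All; _∷_; [])
import Data.Vec.Relation.Unary.All.Properties as All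
open import Data.Vec.Relation.Unary.Any as Any using (Any)
import Data.Vec.Relation.Unary.Any.Properties as Any
open import Function.Base using (_∘_; id)
open import Function.Bundles using (_⇔_; mk⇔; module Equivalence)
open import Level using (Level)
open import Relation.Binary.PropositionalEquality
  using (_≡_; _≢_; _≗_; refl; sym; trans; cong; cong₂; subst; module ≡-Reasoning)
open import Relation.Nullary using (¬_; yes; no; does; contradiction)
open import Relation.Nullary.Decidable using (dec-true; dec-false; ¬?)
open import Relation.Unary using (Pred)

-- C and C′ stand for sets of constant and operation symbols, K for a set of
-- predicate symbols.

private
  variable
    ℓ      : Level
    T      : Set ℓ
    C C′ K : Set ℓ

-- Functions on variables

infixl 8 _[_↦_]

-- θ [ x ↦ t ] maps x to t and agrees with θ elsewhere.

_[_↦_] : (Var → T) → Var → T → Var → T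
(θ [ x ↦ t ]) y = if does (y ≟ x) then t else θ y

↦-hit : ∀ (θ : Var → T) x t → (θ [ x ↦ t ]) x ≡ t
↦-hit θ x t rewrite dec-true (x ≟ x) refl = refl

↦-miss : ∀ (θ : Var → T) {x y} t → y ≢ x → (θ [ x ↦ t ]) y ≡ θ y
↦-miss θ {x} {y} t y≢x rewrite dec-false (y ≟ x) y≢x = refl

↦-elim : ∀ {ℓ ℓ′} {T : Set ℓ} (Q : Var → T → Set ℓ′) {θ : Var → T} {x t} →
         Q x t → (∀ y → y ≢ x → Q y (θ y)) → ∀ y → Q y ((θ [ x ↦ t ]) y)
↦-elim Q {θ} {x} {t} hit miss y with y ≟ x
... | yes refl = subst (Q y) (sym (↦-hit θ y t)) hit
... | no  y≢x  = subst (Q y) (sym (↦-miss θ t y≢x)) (miss y y≢x)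

↦-same : ∀ (θ : Var → T) x → θ [ x ↦ θ x ] ≗ θ
↦-same θ x = ↦-elim (λ y t → t ≡ θ y) refl (λ _ _ → refl)

↦-overwrite : ∀ (θ : Var → T) x s t → θ [ x ↦ s ] [ x ↦ t ] ≗ θ [ x ↦ t ]
↦-overwrite θ x s t = ↦-elim (λ y u → u ≡ (θ [ x ↦ t ]) y) (sym (↦-hit θ x t))
  (λ y y≢x → trans (↦-miss θ s y≢x) (sym (↦-miss θ t y≢x)))

↦-comm : ∀ (θ : Var → T) {x y} s t → x ≢ y →
         θ [ x ↦ s ] [ y ↦ t ] ≗ θ [ y ↦ t ] [ x ↦ s ]
↦-comm θ {x} {y} s t x≢y z with z ≟ x | z ≟ y
... | yes refl | _        = trans (↦-miss (θ [ x ↦ s ]) t x≢y)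
  (trans (↦-hit θ x s) (sym (↦-hit (θ [ y ↦ t ]) x s)))
... | no z≢x   | yes refl = trans (↦-hit (θ [ x ↦ s ]) y t)
  (sym (trans (↦-miss (θ [ y ↦ t ]) s z≢x) (↦-hit θ y t)))
... | no z≢x   | no z≢y   =
  trans (trans (↦-miss (θ [ x ↦ s ]) t z≢y) (↦-miss θ s z≢x))
    (sym (trans (↦-miss (θ [ y ↦ t ]) s z≢x) (↦-miss θ t z≢y)))

-- Simultaneous substitution in lists

-- bind f θ s replaces every variable x of s by θ x and every symbol a by f a.

bindSymbol : (C → C′) → (Var → Str C′) → Symbol C → Str C′
bindSymbol f θ (var x) = θ x
bindSymbol f θ (op a)  = op (f a) ∷ []
bindSymbol f θ lpar    = lpar ∷ []
bindSymbol f θ rpar    = rpar ∷ []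

bind : (C → C′) → (Var → Str C′) → Str C → Str C′
bind f θ = List.concatMap (bindSymbol f θ)

bind-⟪⟫ : ∀ (f : C → C′) θ x → bind f θ ⟪ x ⟫ ≡ θ x
bind-⟪⟫ f θ x = ++-identityʳ (θ x)

bind-cong : ∀ (f : C → C′) {θ θ′} s → (∀ y → y ∈var s → θ y ≡ θ′ y) → bind f θ s ≡ bind f θ′ s
bind-cong f []          h = refl
bind-cong f (var y ∷ s) h = cong₂ _++_ (h y (here refl)) (bind-cong f s (λ z → h z ∘ there))
bind-cong f (op a ∷ s)  h = cong (_ ∷_) (bind-cong f s (λ z → h z ∘ there))
bind-cong f (lpar ∷ s)  h = cong (_ ∷_) (bind-cong f s (λ z → h z ∘ there))
bind-cong f (rpar ∷ s)  h = cong (_ ∷_) (bind-cong f s (λ z → h z ∘ there))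

map≡bind : ∀ (f : C → C′) s → mapStr f s ≡ bind f ⟪_⟫ s
map≡bind f []          = refl
map≡bind f (var y ∷ s) = cong (_ ∷_) (map≡bind f s)
map≡bind f (op a ∷ s)  = cong (_ ∷_) (map≡bind f s)
map≡bind f (lpar ∷ s)  = cong (_ ∷_) (map≡bind f s)
map≡bind f (rpar ∷ s)  = cong (_ ∷_) (map≡bind f s)

subst≡bind : ∀ (s t : Str C) x → s [ t / x ] ≡ bind id (⟪_⟫ [ x ↦ t ]) s
subst≡bind []          t x = refl
subst≡bind (var y ∷ s) t x = cong (_ ++_) (subst≡bind s t x)
subst≡bind (op a ∷ s)  t x = cong (_ ∷_) (subst≡bind s t x)
subst≡bind (lpar ∷ s)  t x = cong (_ ∷_) (subst≡bind s t x)
subst≡bind (rpar ∷ s)  t x = cong (_ ∷_) (subst≡bind s t x)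

bind-bind : ∀ {M : Set ℓ} (g : C′ → M) η (f : C → C′) θ s →
            bind g η (bind f θ s) ≡ bind (g ∘ f) (bind g η ∘ θ) s
bind-bind g η f θ []          = refl
bind-bind g η f θ (var y ∷ s) = trans (concatMap-++ (bindSymbol g η) (θ y) (bind f θ s))
  (cong (_ ++_) (bind-bind g η f θ s))
bind-bind g η f θ (op a ∷ s)  = cong (_ ∷_) (bind-bind g η f θ s)
bind-bind g η f θ (lpar ∷ s)  = cong (_ ∷_) (bind-bind g η f θ s)
bind-bind g η f θ (rpar ∷ s)  = cong (_ ∷_) (bind-bind g η f θ s)

bind-map : ∀ (f : C → C′) θ s → bind id θ (mapStr f s) ≡ bind f θ s
bind-map f θ s = begin
  bind id θ (mapStr f s)      ≡⟨ cong (bind id θ) (map≡bind f s) ⟩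
  bind id θ (bind f ⟪_⟫ s)    ≡⟨ bind-bind id θ f ⟪_⟫ s ⟩
  bind f (bind id θ ∘ ⟪_⟫) s  ≡⟨ bind-cong f s (λ y _ → bind-⟪⟫ id θ y) ⟩
  bind f θ s                  ∎
  where open ≡-Reasoning

bind-subst : ∀ (f : C → C′) θ s t x →
             bind f θ (s [ t / x ]) ≡ bind f (θ [ x ↦ bind f θ t ]) s
bind-subst f θ s t x = begin
  bind f θ (s [ t / x ])                     ≡⟨ cong (bind f θ) (subst≡bind s t x) ⟩
  bind f θ (bind id (⟪_⟫ [ x ↦ t ]) s)       ≡⟨ bind-bind f θ id (⟪_⟫ [ x ↦ t ]) s ⟩
  bind f (bind f θ ∘ (⟪_⟫ [ x ↦ t ])) s      ≡⟨ bind-cong f s (λ y _ → pointwise y) ⟩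
  bind f (θ [ x ↦ bind f θ t ]) s            ∎
  where
  open ≡-Reasoning
  pointwise : bind f θ ∘ (⟪_⟫ [ x ↦ t ]) ≗ θ [ x ↦ bind f θ t ]
  pointwise = ↦-elim (λ y u → bind f θ u ≡ (θ [ x ↦ bind f θ t ]) y)
    (sym (↦-hit θ x _))
    (λ y y≢x → trans (bind-⟪⟫ f θ y) (sym (↦-miss θ _ y≢x)))

subst-bind : ∀ (f : C → C′) θ s t x → bind f θ s [ t / x ] ≡ bind f (λ y → θ y [ t / x ]) s
subst-bind f θ s t x = begin
  bind f θ s [ t / x ]                     ≡⟨ subst≡bind (bind f θ s) t x ⟩
  bind id (⟪_⟫ [ x ↦ t ]) (bind f θ s)     ≡⟨ bind-bind id (⟪_⟫ [ x ↦ t ]) f θ s ⟩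
  bind f (bind id (⟪_⟫ [ x ↦ t ]) ∘ θ) s   ≡⟨ bind-cong f s (λ y _ → sym (subst≡bind (θ y) t x)) ⟩
  bind f (λ y → θ y [ t / x ]) s           ∎
  where open ≡-Reasoning

bind-id : ∀ (s : Str C) → bind id ⟪_⟫ s ≡ s
bind-id []          = refl
bind-id (var x ∷ s) = cong (_ ∷_) (bind-id s)
bind-id (op a ∷ s)  = cong (_ ∷_) (bind-id s)
bind-id (lpar ∷ s)  = cong (_ ∷_) (bind-id s)
bind-id (rpar ∷ s)  = cong (_ ∷_) (bind-id s)

bind-idle : ∀ θ (s : Str C) → (∀ y → ¬ (y ∈var s)) → bind id θ s ≡ s
bind-idle θ s closed = trans (bind-cong id s (λ y y∈s → contradiction y∈s (closed y))) (bind-id s)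

∈-bind⁻ : ∀ (f : C → C′) θ s {y} → y ∈var bind f θ s → ∃ λ z → z ∈var s × y ∈var θ z
∈-bind⁻ f θ (var z ∷ s) y∈ with ∈-++⁻ (θ z) y∈
... | inj₁ y∈θz = z , here refl , y∈θz
... | inj₂ y∈s  with ∈-bind⁻ f θ s y∈s
...   | w , w∈s , y∈θw = w , there w∈s , y∈θw
∈-bind⁻ f θ (op a ∷ s) (there y∈) with ∈-bind⁻ f θ s y∈
... | w , w∈s , y∈θw = w , there w∈s , y∈θw
∈-bind⁻ f θ (lpar ∷ s) (there y∈) with ∈-bind⁻ f θ s y∈
... | w , w∈s , y∈θw = w , there w∈s , y∈θw
∈-bind⁻ f θ (rpar ∷ s) (there y∈) with ∈-bind⁻ f θ s y∈
... | w , w∈s , y∈θw = w , there w∈s , y∈θw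

-- Simultaneous substitution in formulas

-- inst f θ F replaces the free variables x of F by θ x and the symbols a by
-- f a.  Nothing is renamed, so variables of θ x may be captured.

inst : (C → C′) → (Var → Str C′) → Formula C K → Formula C′ K
inst f θ (s ≐ t)     = bind f θ s ≐ bind f θ t
inst f θ (pred₀ p)   = pred₀ p
inst f θ (pred p ts) = pred p (Vec.map (bind f θ) ts)
inst f θ (¬̇ F)       = ¬̇ inst f θ F
inst f θ (F →̇ G)     = inst f θ F →̇ inst f θ G
inst f θ (F ↔̇ G)     = inst f θ F ↔̇ inst f θ G
inst f θ (F ∧̇ G)     = inst f θ F ∧̇ inst f θ G
inst f θ (F ∨̇ G)     = inst f θ F ∨̇ inst f θ G
inst f θ (∀̇ x F)     = ∀̇ x (inst f (θ [ x ↦ ⟪ x ⟫ ]) F)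
inst f θ (∃̇ x F)     = ∃̇ x (inst f (θ [ x ↦ ⟪ x ⟫ ]) F)

inst-cong : ∀ (f : C → C′) {θ θ′} (F : Formula C K) →
            (∀ y → y ∈free F → θ y ≡ θ′ y) → inst f θ F ≡ inst f θ′ F

inst-cong-body : ∀ (f : C → C′) {θ θ′} x (F : Formula C K) →
                 (∀ y → y ≢ x → y ∈free F → θ y ≡ θ′ y) →
                 inst f (θ [ x ↦ ⟪ x ⟫ ]) F ≡ inst f (θ′ [ x ↦ ⟪ x ⟫ ]) F
inst-cong-body f {θ} {θ′} x F h = inst-cong f F
  (↦-elim (λ y t → y ∈free F → t ≡ (θ′ [ x ↦ ⟪ x ⟫ ]) y)
    (λ _ → sym (↦-hit θ′ x ⟪ x ⟫))
    (λ y y≢x y∈F → trans (h y y≢x y∈F) (sym (↦-miss θ′ ⟪ x ⟫ y≢x))))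

inst-cong f (s ≐ t)     h = cong₂ _≐_ (bind-cong f s (λ y → h y ∘ inj₁)) (bind-cong f t (λ y → h y ∘ inj₂))
inst-cong f (pred₀ p)   h = refl
inst-cong f {θ} {θ′} (pred p ts) h = cong (pred p) (go ts h)
  where
  go : ∀ {n} (ts : Vec (Str _) n) → (∀ y → Any (y ∈var_) ts → θ y ≡ θ′ y) →
       Vec.map (bind f θ) ts ≡ Vec.map (bind f θ′) ts
  go []       h = refl
  go (t ∷ ts) h = cong₂ _∷_ (bind-cong f t (λ y → h y ∘ Any.here)) (go ts (λ y → h y ∘ Any.there))
inst-cong f (¬̇ F)       h = cong ¬̇_ (inst-cong f F h)
inst-cong f (F →̇ G)     h = cong₂ _→̇_ (inst-cong f F (λ y → h y ∘ inj₁)) (inst-cong f G (λ y → h y ∘ inj₂))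
inst-cong f (F ↔̇ G)     h = cong₂ _↔̇_ (inst-cong f F (λ y → h y ∘ inj₁)) (inst-cong f G (λ y → h y ∘ inj₂))
inst-cong f (F ∧̇ G)     h = cong₂ _∧̇_ (inst-cong f F (λ y → h y ∘ inj₁)) (inst-cong f G (λ y → h y ∘ inj₂))
inst-cong f (F ∨̇ G)     h = cong₂ _∨̇_ (inst-cong f F (λ y → h y ∘ inj₁)) (inst-cong f G (λ y → h y ∘ inj₂))
inst-cong f (∀̇ x F)     h = cong (∀̇ x) (inst-cong-body f x F (λ y y≢x y∈F → h y (y≢x , y∈F)))
inst-cong f (∃̇ x F)     h = cong (∃̇ x) (inst-cong-body f x F (λ y y≢x y∈F → h y (y≢x , y∈F)))

inst-cong-≗ : ∀ (f : C → C′) {θ θ′} (F : Formula C K) → θ ≗ θ′ → inst f θ F ≡ inst f θ′ F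
inst-cong-≗ f F h = inst-cong f F (λ y _ → h y)

inst-map : ∀ (f : C → C′) θ (F : Formula C K) → inst id θ (mapFormula f F) ≡ inst f θ F
inst-map f θ (s ≐ t)     = cong₂ _≐_ (bind-map f θ s) (bind-map f θ t)
inst-map f θ (pred₀ p)   = refl
inst-map f θ (pred p ts) = cong (pred p)
  (trans (sym (Vec.map-∘ (bind id θ) (mapStr f) ts)) (Vec.map-cong (bind-map f θ) ts))
inst-map f θ (¬̇ F)       = cong ¬̇_ (inst-map f θ F)
inst-map f θ (F →̇ G)     = cong₂ _→̇_ (inst-map f θ F) (inst-map f θ G)
inst-map f θ (F ↔̇ G)     = cong₂ _↔̇_ (inst-map f θ F) (inst-map f θ G)
inst-map f θ (F ∧̇ G)     = cong₂ _∧̇_ (inst-map f θ F) (inst-map f θ G)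
inst-map f θ (F ∨̇ G)     = cong₂ _∨̇_ (inst-map f θ F) (inst-map f θ G)
inst-map f θ (∀̇ x F)     = cong (∀̇ x) (inst-map f _ F)
inst-map f θ (∃̇ x F)     = cong (∃̇ x) (inst-map f _ F)

inst-idle : ∀ θ (F : Formula C K) → (∀ y → ¬ (y ∈free F)) → inst id θ F ≡ F
inst-idle θ F closed = trans (inst-cong id F (λ y y∈F → contradiction y∈F (closed y))) (inst-⟪⟫ F)
  where
  inst-⟪⟫ : ∀ F → inst id ⟪_⟫ F ≡ F
  inst-⟪⟫ (s ≐ t)     = cong₂ _≐_ (bind-id s) (bind-id t)
  inst-⟪⟫ (pred₀ p)   = refl
  inst-⟪⟫ (pred p ts) = cong (pred p) (trans (Vec.map-cong bind-id ts) (Vec.map-id ts))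
  inst-⟪⟫ (¬̇ F)       = cong ¬̇_ (inst-⟪⟫ F)
  inst-⟪⟫ (F →̇ G)     = cong₂ _→̇_ (inst-⟪⟫ F) (inst-⟪⟫ G)
  inst-⟪⟫ (F ↔̇ G)     = cong₂ _↔̇_ (inst-⟪⟫ F) (inst-⟪⟫ G)
  inst-⟪⟫ (F ∧̇ G)     = cong₂ _∧̇_ (inst-⟪⟫ F) (inst-⟪⟫ G)
  inst-⟪⟫ (F ∨̇ G)     = cong₂ _∨̇_ (inst-⟪⟫ F) (inst-⟪⟫ G)
  inst-⟪⟫ (∀̇ x F)     = cong (∀̇ x) (trans (inst-cong-≗ id F (↦-same ⟪_⟫ x)) (inst-⟪⟫ F))
  inst-⟪⟫ (∃̇ x F)     = cong (∃̇ x) (trans (inst-cong-≗ id F (↦-same ⟪_⟫ x)) (inst-⟪⟫ F))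

-- The substitution lemma.  Collision-freeness is what makes t keep its meaning
-- below a quantifier ∀̇ y: there θ is reset at y, which does not occur in t if
-- x is free below the quantifier.

inst-SbF : ∀ (f : C → C′) θ (F : Formula C K) t x → CF F t x →
           inst f θ (SbF F t x) ≡ inst f (θ [ x ↦ bind f θ t ]) F

inst-SbF-body : ∀ (f : C → C′) θ (F : Formula C K) {t x y} → y ≢ x →
                CF F t x × (x ∈free F → ¬ (y ∈var t)) →
                inst f (θ [ y ↦ ⟪ y ⟫ ]) (SbF F t x) ≡
                inst f (θ [ x ↦ bind f θ t ] [ y ↦ ⟪ y ⟫ ]) F
inst-SbF-body f θ F {t} {x} {y} y≢x (cf , y∉t) = begin
  inst f (θ [ y ↦ ⟪ y ⟫ ]) (SbF F t x)
    ≡⟨ inst-SbF f (θ [ y ↦ ⟪ y ⟫ ]) F t x cf ⟩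
  inst f (θ [ y ↦ ⟪ y ⟫ ] [ x ↦ bind f (θ [ y ↦ ⟪ y ⟫ ]) t ]) F
    ≡⟨ inst-cong f F (↦-elim (λ z u → z ∈free F → u ≡ (θ [ y ↦ ⟪ y ⟫ ] [ x ↦ bind f θ t ]) z)
         (λ x∈F → trans (unaffected (y∉t x∈F)) (sym (↦-hit (θ [ y ↦ ⟪ y ⟫ ]) x _)))
         (λ z z≢x _ → sym (↦-miss (θ [ y ↦ ⟪ y ⟫ ]) _ z≢x))) ⟩
  inst f (θ [ y ↦ ⟪ y ⟫ ] [ x ↦ bind f θ t ]) F
    ≡⟨ inst-cong-≗ f F (↦-comm θ _ _ y≢x) ⟩
  inst f (θ [ x ↦ bind f θ t ] [ y ↦ ⟪ y ⟫ ]) F ∎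
  where
  open ≡-Reasoning
  unaffected : ¬ (y ∈var t) → bind f (θ [ y ↦ ⟪ y ⟫ ]) t ≡ bind f θ t
  unaffected y∉t = bind-cong f t (λ z z∈t → ↦-miss θ _ λ { refl → y∉t z∈t })

inst-SbF f θ (r ≐ s)     t x cf = cong₂ _≐_ (bind-subst f θ r t x) (bind-subst f θ s t x)
inst-SbF f θ (pred₀ p)   t x cf = refl
inst-SbF f θ (pred p ts) t x cf = cong (pred p)
  (trans (sym (Vec.map-∘ (bind f θ) _[ t / x ] ts)) (Vec.map-cong (λ s → bind-subst f θ s t x) ts))
inst-SbF f θ (¬̇ F)       t x cf = cong ¬̇_ (inst-SbF f θ F t x cf)
inst-SbF f θ (F →̇ G)     t x (cf , cg) = cong₂ _→̇_ (inst-SbF f θ F t x cf) (inst-SbF f θ G t x cg)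
inst-SbF f θ (F ↔̇ G)     t x (cf , cg) = cong₂ _↔̇_ (inst-SbF f θ F t x cf) (inst-SbF f θ G t x cg)
inst-SbF f θ (F ∧̇ G)     t x (cf , cg) = cong₂ _∧̇_ (inst-SbF f θ F t x cf) (inst-SbF f θ G t x cg)
inst-SbF f θ (F ∨̇ G)     t x (cf , cg) = cong₂ _∨̇_ (inst-SbF f θ F t x cf) (inst-SbF f θ G t x cg)
inst-SbF f θ (∀̇ y F)     t x cf with y ≟ x
... | yes refl rewrite dec-true (x ≟ x) refl =
  cong (∀̇ x) (inst-cong-≗ f F (sym ∘ ↦-overwrite θ x _ _))
... | no  y≢x  rewrite dec-false (y ≟ x) y≢x =
  cong (∀̇ y) (inst-SbF-body f θ F y≢x (cf (y≢x ∘ sym)))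
inst-SbF f θ (∃̇ y F)     t x cf with y ≟ x
... | yes refl rewrite dec-true (x ≟ x) refl =
  cong (∃̇ x) (inst-cong-≗ f F (sym ∘ ↦-overwrite θ x _ _))
... | no  y≢x  rewrite dec-false (y ≟ x) y≢x =
  cong (∃̇ y) (inst-SbF-body f θ F y≢x (cf (y≢x ∘ sym)))

CF-closed : ∀ (F : Formula C K) {t} x → (∀ y → ¬ (y ∈var t)) → CF F t x
CF-closed (s ≐ t)     x c = tt
CF-closed (pred₀ p)   x c = tt
CF-closed (pred p ts) x c = tt
CF-closed (¬̇ F)       x c = CF-closed F x c
CF-closed (F →̇ G)     x c = CF-closed F x c , CF-closed G x c
CF-closed (F ↔̇ G)     x c = CF-closed F x c , CF-closed G x c
CF-closed (F ∧̇ G)     x c = CF-closed F x c , CF-closed G x c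
CF-closed (F ∨̇ G)     x c = CF-closed F x c , CF-closed G x c
CF-closed (∀̇ y F)     x c = λ _ → CF-closed F x c , λ _ → c y
CF-closed (∃̇ y F)     x c = λ _ → CF-closed F x c , λ _ → c y

-- θ x contains no variable other than x, as when θ x is closed or x itself.

OwnOnly : (Var → Str C) → Set _
OwnOnly θ = ∀ x y → y ≢ x → ¬ (y ∈var θ x)

OwnOnly-↦ : ∀ {θ : Var → Str C} z → OwnOnly θ → OwnOnly (θ [ z ↦ ⟪ z ⟫ ])
OwnOnly-↦ z own = ↦-elim (λ x t → ∀ y → y ≢ x → ¬ (y ∈var t))
  (λ { _ y≢z (here refl) → y≢z refl }) (λ x _ → own x)

-- No collision-freeness is needed: variables of t are captured on both sides
-- alike.  OwnOnly matters below a quantifier that binds x: the lists put in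
-- there for other variables do not contain x.

SbF-inst : ∀ (f : C → C′) {θ} → OwnOnly θ → ∀ (F : Formula C K) t x →
           SbF (inst f θ F) t x ≡ inst f (λ y → θ y [ t / x ]) F

SbF-inst-body : ∀ (f : C → C′) {θ} → OwnOnly θ → ∀ (F : Formula C K) t {x y} → y ≢ x →
                SbF (inst f (θ [ y ↦ ⟪ y ⟫ ]) F) t x ≡
                inst f ((λ z → θ z [ t / x ]) [ y ↦ ⟪ y ⟫ ]) F
SbF-inst-body f {θ} own F t {x} {y} y≢x =
  trans (SbF-inst f (OwnOnly-↦ y own) F t x)
    (inst-cong-≗ f F (↦-elim (λ z u → u [ t / x ] ≡ ((λ z → θ z [ t / x ]) [ y ↦ ⟪ y ⟫ ]) z)
      (trans (miss t y≢x) (sym (↦-hit (λ z → θ z [ t / x ]) y _)))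
      (λ z z≢y → sym (↦-miss (λ z → θ z [ t / x ]) _ z≢y))))

-- The case of a quantifier that binds the substituted variable itself.

inst-bound : ∀ (f : C → C′) {θ} → OwnOnly θ → ∀ (F : Formula C K) t x →
             inst f (θ [ x ↦ ⟪ x ⟫ ]) F ≡ inst f ((λ z → θ z [ t / x ]) [ x ↦ ⟪ x ⟫ ]) F
inst-bound f {θ} own F t x = inst-cong-body f x F
  (λ y y≢x _ → sym (subst-idle (θ y) t x (own y x (y≢x ∘ sym))))

SbF-inst f {θ} own (r ≐ s)     t x = cong₂ _≐_ (subst-bind f θ r t x) (subst-bind f θ s t x)
SbF-inst f own (pred₀ p)   t x = refl
SbF-inst f {θ} own (pred p ts) t x = cong (pred p)
  (trans (sym (Vec.map-∘ _[ t / x ] (bind f θ) ts)) (Vec.map-cong (λ s → subst-bind f θ s t x) ts))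
SbF-inst f own (¬̇ F)       t x = cong ¬̇_ (SbF-inst f own F t x)
SbF-inst f own (F →̇ G)     t x = cong₂ _→̇_ (SbF-inst f own F t x) (SbF-inst f own G t x)
SbF-inst f own (F ↔̇ G)     t x = cong₂ _↔̇_ (SbF-inst f own F t x) (SbF-inst f own G t x)
SbF-inst f own (F ∧̇ G)     t x = cong₂ _∧̇_ (SbF-inst f own F t x) (SbF-inst f own G t x)
SbF-inst f own (F ∨̇ G)     t x = cong₂ _∨̇_ (SbF-inst f own F t x) (SbF-inst f own G t x)
SbF-inst f own (∀̇ y F)     t x with y ≟ x
... | yes refl rewrite dec-true (x ≟ x) refl = cong (∀̇ x) (inst-bound f own F t x)
... | no  y≢x  rewrite dec-false (y ≟ x) y≢x = cong (∀̇ y) (SbF-inst-body f own F t y≢x)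
SbF-inst f own (∃̇ y F)     t x with y ≟ x
... | yes refl rewrite dec-true (x ≟ x) refl = cong (∃̇ x) (inst-bound f own F t x)
... | no  y≢x  rewrite dec-false (y ≟ x) y≢x = cong (∃̇ y) (SbF-inst-body f own F t y≢x)

free-inst⁻ : ∀ (f : C → C′) θ (F : Formula C K) {y} → y ∈free inst f θ F →
             ∃ λ z → z ∈free F × y ∈var θ z

free-inst-body⁻ : ∀ (f : C → C′) θ x (F : Formula C K) {y} → y ≢ x →
                  y ∈free inst f (θ [ x ↦ ⟪ x ⟫ ]) F → ∃ λ z → (z ≢ x × z ∈free F) × y ∈var θ z
free-inst-body⁻ f θ x F {y} y≢x y∈ with free-inst⁻ f (θ [ x ↦ ⟪ x ⟫ ]) F y∈
... | z , z∈F , y∈z with z ≟ x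
...   | no  z≢x  = z , (z≢x , z∈F) , subst (y ∈var_) (↦-miss θ _ z≢x) y∈z
...   | yes refl with subst (y ∈var_) (↦-hit θ x _) y∈z
...     | here refl = contradiction refl y≢x

free-inst⁻ f θ (s ≐ t) (inj₁ p) = let z , q , r = ∈-bind⁻ f θ s p in z , inj₁ q , r
free-inst⁻ f θ (s ≐ t) (inj₂ p) = let z , q , r = ∈-bind⁻ f θ t p in z , inj₂ q , r
free-inst⁻ f θ (pred p ts) {y} q = go ts (Any.map⁻ q)
  where
  go : ∀ {n} (ts : Vec (Str _) n) → Any (λ s → y ∈var bind f θ s) ts →
       ∃ λ z → Any (z ∈var_) ts × y ∈var θ z
  go (t ∷ ts) (Any.here p)  = let z , q , r = ∈-bind⁻ f θ t p in z , Any.here q , r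
  go (t ∷ ts) (Any.there p) = let z , q , r = go ts p in z , Any.there q , r
free-inst⁻ f θ (¬̇ F)   p        = free-inst⁻ f θ F p
free-inst⁻ f θ (F →̇ G) (inj₁ p) = let z , q , r = free-inst⁻ f θ F p in z , inj₁ q , r
free-inst⁻ f θ (F →̇ G) (inj₂ p) = let z , q , r = free-inst⁻ f θ G p in z , inj₂ q , r
free-inst⁻ f θ (F ↔̇ G) (inj₁ p) = let z , q , r = free-inst⁻ f θ F p in z , inj₁ q , r
free-inst⁻ f θ (F ↔̇ G) (inj₂ p) = let z , q , r = free-inst⁻ f θ G p in z , inj₂ q , r
free-inst⁻ f θ (F ∧̇ G) (inj₁ p) = let z , q , r = free-inst⁻ f θ F p in z , inj₁ q , r
free-inst⁻ f θ (F ∧̇ G) (inj₂ p) = let z , q , r = free-inst⁻ f θ G p in z , inj₂ q , r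
free-inst⁻ f θ (F ∨̇ G) (inj₁ p) = let z , q , r = free-inst⁻ f θ F p in z , inj₁ q , r
free-inst⁻ f θ (F ∨̇ G) (inj₂ p) = let z , q , r = free-inst⁻ f θ G p in z , inj₂ q , r
free-inst⁻ f θ (∀̇ x F) (y≢x , p) = free-inst-body⁻ f θ x F y≢x p
free-inst⁻ f θ (∃̇ x F) (y≢x , p) = free-inst-body⁻ f θ x F y≢x p

-- R is required to contain the variables because θ is reset below quantifiers.

Over-inst : ∀ {Q : Pred (Str C) ℓ} {R : Pred (Str C′) ℓ} (f : C → C′) →
            (∀ x → R ⟪ x ⟫) →
            (∀ {θ} → OwnOnly θ → (∀ x → R (θ x)) → ∀ {s} → Q s → R (bind f θ s)) →
            ∀ {θ} → OwnOnly θ → (∀ x → R (θ x)) →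
            (F : Formula C K) → Over Q F → Over R (inst f θ F)
Over-inst f v h own r (s ≐ t)     (p , q) = h own r p , h own r q
Over-inst f v h own r (pred₀ p)   _       = tt
Over-inst f v h own r (pred p ts) ps      = All.map⁺ (All.map (h own r) ps)
Over-inst f v h own r (¬̇ F)       p       = Over-inst f v h own r F p
Over-inst f v h own r (F →̇ G)     (p , q) = Over-inst f v h own r F p , Over-inst f v h own r G q
Over-inst f v h own r (F ↔̇ G)     (p , q) = Over-inst f v h own r F p , Over-inst f v h own r G q
Over-inst f v h own r (F ∧̇ G)     (p , q) = Over-inst f v h own r F p , Over-inst f v h own r G q
Over-inst f v h own r (F ∨̇ G)     (p , q) = Over-inst f v h own r F p , Over-inst f v h own r G q
Over-inst {R = R} f v h own r (∀̇ x F) p =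
  Over-inst f v h (OwnOnly-↦ x own) (↦-elim (λ _ → R) (v x) (λ y _ → r y)) F p
Over-inst {R = R} f v h own r (∃̇ x F) p =
  Over-inst f v h (OwnOnly-↦ x own) (↦-elim (λ _ → R) (v x) (λ y _ → r y)) F p

-- Enumeration of the free variables

-- Q has an enumeration, possibly with repetitions.

Finite : ∀ {ℓ} → Pred Var ℓ → Set ℓ
Finite Q = ∃ λ xs → ∀ y → Q y ⇔ y ∈ xs

finite-⊎ : ∀ {Q R : Pred Var ℓ} → Finite Q → Finite R → Finite (λ y → Q y ⊎ R y)
finite-⊎ (xs , f) (ys , g) = xs ++ ys , λ y → mk⇔
  [ ∈-++⁺ˡ ∘ Equivalence.to (f y) , ∈-++⁺ʳ xs ∘ Equivalence.to (g y) ]′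
  ([ inj₁ ∘ Equivalence.from (f y) , inj₂ ∘ Equivalence.from (g y) ]′ ∘ ∈-++⁻ xs)

finite-≢ : ∀ {Q : Pred Var ℓ} x → Finite Q → Finite (λ y → y ≢ x × Q y)
finite-≢ x (xs , f) = List.filter (λ y → ¬? (y ≟ x)) xs , λ y → mk⇔
  (λ (y≢x , q) → ∈-filter⁺ (λ y → ¬? (y ≟ x)) (Equivalence.to (f y) q) y≢x)
  (λ y∈ → let y∈xs , y≢x = ∈-filter⁻ (λ y → ¬? (y ≟ x)) {xs = xs} y∈
          in y≢x , Equivalence.from (f y) y∈xs)

finite-var : (s : Str C) → Finite (_∈var s)
finite-var []          = [] , λ y → mk⇔ (λ ()) (λ ())
finite-var (var x ∷ s) = let xs , f = finite-var s in x ∷ xs , λ y → mk⇔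
  (λ { (here refl) → here refl ; (there p) → there (Equivalence.to (f y) p) })
  (λ { (here refl) → here refl ; (there p) → there (Equivalence.from (f y) p) })
finite-var (op a ∷ s)  = let xs , f = finite-var s in xs , λ y → mk⇔
  (λ { (here ()) ; (there p) → Equivalence.to (f y) p }) (there ∘ Equivalence.from (f y))
finite-var (lpar ∷ s)  = let xs , f = finite-var s in xs , λ y → mk⇔
  (λ { (here ()) ; (there p) → Equivalence.to (f y) p }) (there ∘ Equivalence.from (f y))
finite-var (rpar ∷ s)  = let xs , f = finite-var s in xs , λ y → mk⇔
  (λ { (here ()) ; (there p) → Equivalence.to (f y) p }) (there ∘ Equivalence.from (f y))

finite-free : (F : Formula C K) → Finite (_∈free F)
finite-free (s ≐ t)     = finite-⊎ (finite-var s) (finite-var t)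
finite-free (pred₀ p)   = [] , λ y → mk⇔ (λ ()) (λ ())
finite-free {C = C} (pred p ts) = go ts
  where
  go : ∀ {n} (ts : Vec (Str C) n) → Finite (λ y → Any (y ∈var_) ts)
  go []       = [] , λ y → mk⇔ (λ ()) (λ ())
  go (t ∷ ts) = let xs , f = finite-⊎ (finite-var t) (go ts) in xs , λ y → mk⇔
    (λ { (Any.here p) → Equivalence.to (f y) (inj₁ p) ; (Any.there p) → Equivalence.to (f y) (inj₂ p) })
    ([ Any.here , Any.there ]′ ∘ Equivalence.from (f y))
finite-free (¬̇ F)       = finite-free F
finite-free (F →̇ G)     = finite-⊎ (finite-free F) (finite-free G)
finite-free (F ↔̇ G)     = finite-⊎ (finite-free F) (finite-free G)
finite-free (F ∧̇ G)     = finite-⊎ (finite-free F) (finite-free G)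
finite-free (F ∨̇ G)     = finite-⊎ (finite-free F) (finite-free G)
finite-free (∀̇ x F)     = finite-≢ x (finite-free F)
finite-free (∃̇ x F)     = finite-≢ x (finite-free F)

finite-unique : ∀ {Q : Pred Var ℓ} → Finite Q → ∃ λ xs → Unique xs × (∀ y → Q y ⇔ y ∈ xs)
finite-unique (xs , f) = List.deduplicate _≟_ xs , deduplicate-! _≟_ xs , λ y → mk⇔
  (∈-deduplicate⁺ _≟_ ∘ Equivalence.to (f y))
  (Equivalence.from (f y) ∘ ∈-deduplicate⁻ _≟_ xs)

-- The lists of a system

module _ (S : System ℓ) where
  open System S

  equations-over : ∀ {n} (xs ys : Vec Var n) {F : Formula A P} → Over 𝓛 F → Over 𝓛 (equations xs ys F)
  equations-over []       []       o = o
  equations-over (x ∷ xs) (y ∷ ys) o = (𝓛-var x , 𝓛-var y) , equations-over xs ys o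

  variables-over : ∀ {n} (xs : Vec Var n) → All 𝓛 (Vec.map ⟪_⟫ xs)
  variables-over xs = All.map⁺ (All.universal 𝓛-var xs)

  instantiate-over : ∀ {j} (α : PropForm j) {F : Fin j → Formula A P} →
                     (∀ i → Over 𝓛 (F i)) → Over 𝓛 (instantiate α F)
  instantiate-over (atom i)   o = o i
  instantiate-over (neg a)    o = instantiate-over a o
  instantiate-over (imp a b)  o = instantiate-over a o , instantiate-over b o
  instantiate-over (iff a b)  o = instantiate-over a o , instantiate-over b o
  instantiate-over (conj a b) o = instantiate-over a o , instantiate-over b o
  instantiate-over (disj a b) o = instantiate-over a o , instantiate-over b o

  Provable⇒Over : ∀ {F} → Provable S F → Over 𝓛 F
  Provable⇒Over (basis F∈B)             = B-over F∈B
  Provable⇒Over (tautology α _ F o)     = instantiate-over α o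
  Provable⇒Over (≐-refl x)              = 𝓛-var x , 𝓛-var x
  Provable⇒Over (≐-subst x y s∈ t∈)     =
    (𝓛-subst y s∈ (𝓛-var x) , 𝓛-subst y t∈ (𝓛-var x)) , (𝓛-var x , 𝓛-var y) , s∈ , t∈
  Provable⇒Over (≐-pred p xs ys)        =
    equations-over xs ys (variables-over xs , variables-over ys)
  Provable⇒Over (∀-elim x o)            = o , o
  Provable⇒Over (∀-distrib x oF oG _)   = (oF , oG) , oF , oG
  Provable⇒Over (∃-def x o)             = o , o
  Provable⇒Over (mp _ p)                = proj₂ (Provable⇒Over p)
  Provable⇒Over (subst-rule {F} x t∈ _ p) = Over-SbF x (λ s∈ → 𝓛-subst x s∈ t∈) F (Provable⇒Over p)
  Provable⇒Over (gen x p)               = Provable⇒Over p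

-- restrict n θ agrees with θ on the variables below n and fixes the others.

restrict : ℕ → (Var → Str C) → Var → Str C
restrict n θ x = if does (x <? n) then θ x else ⟪ x ⟫

restrict-< : ∀ {n} (θ : Var → Str C) {x} → x < n → restrict n θ x ≡ θ x
restrict-< {n = n} θ {x} x<n rewrite dec-true (x <? n) x<n = refl

restrict-≮ : ∀ {n} (θ : Var → Str C) {x} → ¬ (x < n) → restrict n θ x ≡ ⟪ x ⟫
restrict-≮ {n = n} θ {x} x≮n rewrite dec-false (x <? n) x≮n = refl

-- Extending the bound by one is a single substitution, because θ n is put in
-- for n only: by OwnOnly, n does not occur in θ x for x below n.

restrict-suc : ∀ n {θ : Var → Str C} → OwnOnly θ → ∀ x →
               restrict (suc n) θ x ≡ restrict n θ x [ θ n / n ]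
restrict-suc n {θ} own x with x <? n | x ≟ n
... | yes x<n | _        = trans (restrict-< θ (m<n⇒m<1+n x<n)) (sym (trans
  (cong _[ θ n / n ] (restrict-< θ x<n))
  (subst-idle (θ x) (θ n) n (own x n λ { refl → <-irrefl refl x<n }))))
... | no  x≮n | yes refl = trans (restrict-< θ (n<1+n x)) (sym (trans
  (cong _[ θ x / x ] (restrict-≮ θ x≮n)) (hit (θ x) x)))
... | no  x≮n | no  x≢n  = trans (restrict-≮ θ ([ x≮n , x≢n ]′ ∘ m<1+n⇒m<n∨m≡n))
  (sym (trans (cong _[ θ n / n ] (restrict-≮ θ x≮n)) (miss (θ n) x≢n)))

module _ (S : System ℓ) where
  open System S

  -- A system is closed under single substitutions only; a simultaneous one with
  -- OwnOnly θ is a sequence of these, over all variables below a bound for s.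

  bind-closure : ∀ (f : C → A) {θ} → OwnOnly θ → (∀ x → 𝓛 (θ x)) →
                 ∀ {s} → 𝓛 (mapStr f s) → 𝓛 (bind f θ s)
  bind-closure f {θ} own θ∈ {s} s∈ = subst 𝓛
    (bind-cong f s (λ y y∈s → restrict-< θ (∈⇒<fresh s y∈s))) (go (fresh s))
    where
    go : ∀ n → 𝓛 (bind f (restrict n θ) s)
    go zero    = subst 𝓛 (map≡bind f s) s∈
    go (suc n) = subst 𝓛
      (trans (subst-bind f (restrict n θ) s (θ n) n)
        (bind-cong f s (λ y _ → sym (restrict-suc n own y))))
      (𝓛-subst n (go n) (θ∈ n))

-- The witness of a refinement is irrelevant, so lists and formulas of the
-- model are equal as soon as the underlying strings and formulas are.

value-injective : ∀ {a p} {X : Set a} {Q : X → Set p} {r r′ : Refinement X Q} →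
                  value r ≡ value r′ → r ≡ r′
value-injective refl = refl

-- Sentences under an assignment

module _ {S : System ℓ} (D : Model S) where
  open System S
  open Model D
  open System Ŝ using () renaming (A to Â; 𝓛 to 𝓛̂; 𝓛-var to 𝓛̂-var; B-over to B̂-over)
  open Closed Ŝ

  -- All values of σ are closed lists of the extended system.

  Grounds : (Var → Str Â) → Set ℓ
  Grounds σ = ∀ x → 𝓛̂ (σ x) × (∀ y → y ∈var σ x → y ∈ [])

  -- An assignment of closed lists to all variables.  The irrelevant witness is
  -- for the whole function, rather than for each of its values.

  Assignment : Set ℓ
  Assignment = [ σ ∈ (Var → Str Â) ∣ Grounds σ ]

  infixl 8 _[_≔_]

  -- Reassignment of a single variable

  _[_≔_] : Assignment → Var → ClosedList → Assignment
  (σ , [ p ]) [ x ≔ (l , [ q ]) ] = σ [ x ↦ l ] ,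
    [ ↦-elim (λ _ t → 𝓛̂ t × (∀ y → y ∈var t → y ∈ [])) q (λ y _ → p y) ]

  -- The closed list that σ assigns to x

  at : Assignment → Var → ClosedList
  at (σ , [ p ]) x = σ x , [ p x ]

  closed-∉ : (l : ClosedList) → ∀ y → ¬ (y ∈var value l)
  closed-∉ (s , [ p ]) y y∈ = ⊥-elim-irr (∉[] (proj₂ p y y∈))

  -- σ with x left in place

  except : Assignment → Var → Var → Str Â
  except σ x = value σ [ x ↦ ⟪ x ⟫ ]

  ownOnly : ∀ σ → OwnOnly (value σ)
  ownOnly σ x y _ = closed-∉ (at σ x) y

  bind-𝓛̂ : ∀ {θ} → OwnOnly θ → (∀ x → 𝓛̂ (θ x)) → ∀ {s} → 𝓛 s → 𝓛̂ (bind inj₁ θ s)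
  bind-𝓛̂ o θ∈ s∈ = bind-closure Ŝ inj₁ o θ∈ (zero , base s∈)

  -- The sentence F under σ

  close : Assignment → (F : Formula A P) → .(Over 𝓛 F) → Sentence
  close σ̂@(σ , [ p ]) F o = inst inj₁ σ F ,
    [ (Over-inst inj₁ 𝓛̂-var bind-𝓛̂ (ownOnly σ̂) (λ x → proj₁ (p x)) F o ,
       λ y y∈ → let z , _ , y∈z = free-inst⁻ inj₁ σ F y∈ in proj₂ (p z) y y∈z) ]

  -- The closed list s under σ

  closeList : Assignment → (s : Str A) → .(𝓛 s) → ClosedList
  closeList σ̂@(σ , [ p ]) s s∈ = bind inj₁ σ s ,
    [ (bind-𝓛̂ (ownOnly σ̂) (λ x → proj₁ (p x)) s∈ ,
       λ y y∈ → let z , _ , y∈z = ∈-bind⁻ inj₁ σ s y∈ in proj₂ (p z) y y∈z) ]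

  except-free : ∀ {θ : Var → Str Â} x → Grounds θ →
                ∀ z y → y ∈var (θ [ x ↦ ⟪ x ⟫ ]) z → y ∈ x ∷ []
  except-free x p = ↦-elim (λ z t → ∀ y → y ∈var t → y ∈ x ∷ [])
    (λ { y (here refl) → here refl })
    (λ z _ y y∈ → contradiction (proj₂ (p z) y y∈) ∉[])

  except-𝓛̂ : ∀ {θ : Var → Str Â} x → Grounds θ →
              ∀ z → 𝓛̂ ((θ [ x ↦ ⟪ x ⟫ ]) z)
  except-𝓛̂ x p = ↦-elim (λ _ → 𝓛̂) (𝓛̂-var x) (λ z _ → proj₁ (p z))

  -- F under σ with x left in place

  closeBut : ∀ x → Assignment → (F : Formula A P) → .(Over 𝓛 F) → FormulaIn (x ∷ [])
  closeBut x σ̂@(σ , [ p ]) F o = inst inj₁ (σ [ x ↦ ⟪ x ⟫ ]) F ,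
    [ (Over-inst inj₁ 𝓛̂-var bind-𝓛̂ (OwnOnly-↦ x (ownOnly σ̂)) (except-𝓛̂ x p) F o ,
       λ y y∈ → let z , _ , y∈z = free-inst⁻ inj₁ _ F y∈ in except-free x p z y y∈z) ]

  -- s under σ with x left in place

  closeListBut : ∀ x → Assignment → (s : Str A) → .(𝓛 s) → ListIn (x ∷ [])
  closeListBut x σ̂@(σ , [ p ]) s s∈ = bind inj₁ (σ [ x ↦ ⟪ x ⟫ ]) s ,
    [ (bind-𝓛̂ (OwnOnly-↦ x (ownOnly σ̂)) (except-𝓛̂ x p) s∈ ,
       λ y y∈ → let z , _ , y∈z = ∈-bind⁻ inj₁ _ s y∈ in except-free x p z y y∈z) ]

  except-subst : ∀ σ x l → (λ y → except σ x y [ value l / x ]) ≗ value (σ [ x ≔ l ])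
  except-subst σ x l = ↦-elim (λ y t → t [ value l / x ] ≡ value (σ [ x ≔ l ]) y)
    (trans (hit (value l) x) (sym (↦-hit (value σ) x (value l))))
    (λ y y≢x → trans (subst-idle (value σ y) (value l) x (closed-∉ (at σ y) x))
                     (sym (↦-miss (value σ) (value l) y≢x)))

  substFormula-closeBut : ∀ x σ F .(o : Over 𝓛 F) l →
                          substFormula (closeBut x σ F o) l ≡ close (σ [ x ≔ l ]) F o
  substFormula-closeBut x σ F o l = value-injective
    (trans (SbF-inst inj₁ (OwnOnly-↦ x (ownOnly σ)) F (value l) x)
           (inst-cong-≗ inj₁ F (except-subst σ x l)))

  substList-closeListBut : ∀ x σ s .(s∈ : 𝓛 s) l →
                           substList (closeListBut x σ s s∈) l ≡ closeList (σ [ x ≔ l ]) s s∈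
  substList-closeListBut x σ s s∈ l = value-injective
    (trans (subst-bind inj₁ (except σ x) s (value l) x)
           (bind-cong inj₁ s (λ y _ → except-subst σ x l y)))

  truth-close-∀ : ∀ x σ F .(o : Over 𝓛 F) →
                  (truth (close σ (∀̇ x F) o) ≡ true) ⇔
                  (∀ l → truth (close (σ [ x ≔ l ]) F o) ≡ true)
  truth-close-∀ x σ F o = mk⇔
    (λ h l → trans (cong truth (sym (substFormula-closeBut x σ F o l)))
                   (Equivalence.to (truth-∀ x (closeBut x σ F o)) h l))
    (λ h → Equivalence.from (truth-∀ x (closeBut x σ F o))
      (λ l → trans (cong truth (substFormula-closeBut x σ F o l)) (h l)))

  truth-close-∃ : ∀ x σ F .(o : Over 𝓛 F) →
                  (truth (close σ (∃̇ x F) o) ≡ true) ⇔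
                  (∃ λ l → truth (close (σ [ x ≔ l ]) F o) ≡ true)
  truth-close-∃ x σ F o = mk⇔
    (λ h → let l , q = Equivalence.to (truth-∃ x (closeBut x σ F o)) h
           in l , trans (cong truth (sym (substFormula-closeBut x σ F o l))) q)
    (λ (l , q) → Equivalence.from (truth-∃ x (closeBut x σ F o))
      (l , trans (cong truth (substFormula-closeBut x σ F o l)) q))

  →-intro : ∀ F G → (truth F ≡ true → truth G ≡ true) → truth (F →ˢ G) ≡ true
  →-intro F G h = trans (truth-→ F G) (lemma (truth F) h)
    where
    lemma : ∀ a {b} → (a ≡ true → b ≡ true) → (a →ᵇ b) ≡ true
    lemma true  h = h refl
    lemma false h = refl

  →-elim : ∀ F G → truth (F →ˢ G) ≡ true → truth F ≡ true → truth G ≡ true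
  →-elim F G h f = lemma f (trans (sym (truth-→ F G)) h)
    where
    lemma : ∀ {a b} → a ≡ true → (a →ᵇ b) ≡ true → b ≡ true
    lemma refl h = h

  -- ⟦⟧-subst passes from l to the name of ⟦ l ⟧, which is also that of ⟦ l′ ⟧.

  ⟦⟧-congruent : ∀ x {s} .(s∈ : 𝓛 s) σ {l l′} → ⟦ l ⟧ ≡ ⟦ l′ ⟧ →
                 ⟦ closeList (σ [ x ≔ l ]) s s∈ ⟧ ≡ ⟦ closeList (σ [ x ≔ l′ ]) s s∈ ⟧
  ⟦⟧-congruent x {s} s∈ σ {l} {l′} eq = begin
    ⟦ closeList (σ [ x ≔ l ]) s s∈ ⟧    ≡⟨ cong ⟦_⟧ (substList-closeListBut x σ s s∈ l) ⟨
    ⟦ substList ŝ l ⟧                   ≡⟨ ⟦⟧-subst x ŝ l ⟩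
    ⟦ substList ŝ (nameOf ⟦ l ⟧) ⟧      ≡⟨ cong (λ d → ⟦ substList ŝ (nameOf d) ⟧) eq ⟩
    ⟦ substList ŝ (nameOf ⟦ l′ ⟧) ⟧     ≡⟨ ⟦⟧-subst x ŝ l′ ⟨
    ⟦ substList ŝ l′ ⟧                  ≡⟨ cong ⟦_⟧ (substList-closeListBut x σ s s∈ l′) ⟩
    ⟦ closeList (σ [ x ≔ l′ ]) s s∈ ⟧   ∎
    where
    open ≡-Reasoning
    ŝ = closeListBut x σ s s∈

  closeList-⟪⟫ : ∀ σ x .(x∈ : 𝓛 ⟪ x ⟫) → closeList σ ⟪ x ⟫ x∈ ≡ at σ x
  closeList-⟪⟫ σ x _ = value-injective (bind-⟪⟫ inj₁ (value σ) x)

  -- Both sides are s under σ with y reassigned: to the list of x on the left, to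
  -- its own list on the right.

  closeList-replace : ∀ σ x y {s} .(s∈ : 𝓛 s) .(s′∈ : 𝓛 (s [ ⟪ x ⟫ / y ])) →
                      ⟦ at σ x ⟧ ≡ ⟦ at σ y ⟧ →
                      ⟦ closeList σ (s [ ⟪ x ⟫ / y ]) s′∈ ⟧ ≡ ⟦ closeList σ s s∈ ⟧
  closeList-replace σ x y {s} s∈ s′∈ eq = begin
    ⟦ closeList σ (s [ ⟪ x ⟫ / y ]) s′∈ ⟧
      ≡⟨ cong ⟦_⟧ (value-injective (trans (bind-subst inj₁ (value σ) s ⟪ x ⟫ y)
           (cong (λ t → bind inj₁ (value σ [ y ↦ t ]) s) (bind-⟪⟫ inj₁ (value σ) x)))) ⟩
    ⟦ closeList (σ [ y ≔ at σ x ]) s s∈ ⟧ ≡⟨ ⟦⟧-congruent y s∈ σ eq ⟩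
    ⟦ closeList (σ [ y ≔ at σ y ]) s s∈ ⟧
      ≡⟨ cong ⟦_⟧ (value-injective (bind-cong inj₁ s (λ z _ → ↦-same (value σ) y z))) ⟩
    ⟦ closeList σ s s∈ ⟧ ∎
    where open ≡-Reasoning

  -- Soundness

  -- F is true in the model under every assignment.

  True : (F : Formula A P) → .(Over 𝓛 F) → Set ℓ
  True F o = ∀ σ → truth (close σ F o) ≡ true

  true-tautology : ∀ {j} (α : PropForm j) → Tautology α → (F : Fin j → Formula A P) →
                   .(o : ∀ i → Over 𝓛 (F i)) .(oα : Over 𝓛 (instantiate α F)) →
                   True (instantiate α F) oα
  true-tautology α taut F o oα σ = trans (truth-instantiate α oα) (taut _)
    where
    truth-instantiate : ∀ α .(oα : Over 𝓛 (instantiate α F)) →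
      truth (close σ (instantiate α F) oα) ≡ eval (λ i → truth (close σ (F i) (o i))) α
    truth-instantiate (atom i)   oα = refl
    truth-instantiate (neg a)    oα =
      trans (truth-¬ (close σ (instantiate a F) oα)) (cong not (truth-instantiate a oα))
    truth-instantiate (imp a b)  oα =
      trans (truth-→ (close σ (instantiate a F) (proj₁ oα)) (close σ (instantiate b F) (proj₂ oα)))
            (cong₂ _→ᵇ_ (truth-instantiate a (proj₁ oα)) (truth-instantiate b (proj₂ oα)))
    truth-instantiate (iff a b)  oα =
      trans (truth-↔ (close σ (instantiate a F) (proj₁ oα)) (close σ (instantiate b F) (proj₂ oα)))
            (cong₂ _↔ᵇ_ (truth-instantiate a (proj₁ oα)) (truth-instantiate b (proj₂ oα)))
    truth-instantiate (conj a b) oα =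
      trans (truth-∧ (close σ (instantiate a F) (proj₁ oα)) (close σ (instantiate b F) (proj₂ oα)))
            (cong₂ _∧_ (truth-instantiate a (proj₁ oα)) (truth-instantiate b (proj₂ oα)))
    truth-instantiate (disj a b) oα =
      trans (truth-∨ (close σ (instantiate a F) (proj₁ oα)) (close σ (instantiate b F) (proj₂ oα)))
            (cong₂ _∨_ (truth-instantiate a (proj₁ oα)) (truth-instantiate b (proj₂ oα)))

  true-⟪⟫≐⟪⟫ : ∀ σ x y .(o : 𝓛 ⟪ x ⟫ × 𝓛 ⟪ y ⟫) →
               (truth (close σ (⟪ x ⟫ ≐ ⟪ y ⟫) o) ≡ true) ⇔ (⟦ at σ x ⟧ ≡ ⟦ at σ y ⟧)
  true-⟪⟫≐⟪⟫ σ x y o = mk⇔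
    (λ h → trans (cong ⟦_⟧ (sym x̂)) (trans (Equivalence.to (truth-≐ _ _) h) (cong ⟦_⟧ ŷ)))
    (λ h → Equivalence.from (truth-≐ (closeList σ ⟪ x ⟫ (proj₁ o)) (closeList σ ⟪ y ⟫ (proj₂ o)))
             (trans (cong ⟦_⟧ x̂) (trans h (cong ⟦_⟧ (sym ŷ)))))
    where
    x̂ = closeList-⟪⟫ σ x (proj₁ o)
    ŷ = closeList-⟪⟫ σ y (proj₂ o)

  close-pred-⟪⟫ : ∀ σ p {n} (xs : Vec Var (suc n)) .(o : All 𝓛 (Vec.map ⟪_⟫ xs)) →
                  close σ (pred p (Vec.map ⟪_⟫ xs)) o ≡ predˢ p (Vec.map (at σ) xs)
  close-pred-⟪⟫ σ p xs o = value-injective (cong (pred p) (begin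
    Vec.map (bind inj₁ (value σ)) (Vec.map ⟪_⟫ xs) ≡⟨ Vec.map-∘ (bind inj₁ (value σ)) ⟪_⟫ xs ⟨
    Vec.map (bind inj₁ (value σ) ∘ ⟪_⟫) xs         ≡⟨ Vec.map-cong (bind-⟪⟫ inj₁ (value σ)) xs ⟩
    Vec.map (value ∘ at σ) xs                      ≡⟨ Vec.map-∘ value (at σ) xs ⟩
    Vec.map value (Vec.map (at σ) xs)              ∎))
    where open ≡-Reasoning

  true-equations : ∀ σ {n} (xs ys : Vec Var n) {F} .(o : Over 𝓛 F)
                   .(o′ : Over 𝓛 (equations xs ys F)) →
                   (Vec.map (⟦_⟧ ∘ at σ) xs ≡ Vec.map (⟦_⟧ ∘ at σ) ys →
                     truth (close σ F o) ≡ true) →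
                   truth (close σ (equations xs ys F) o′) ≡ true
  true-equations σ []       []       o o′ h = h refl
  true-equations σ (x ∷ xs) (y ∷ ys) o o′ h =
    →-intro (close σ (⟪ x ⟫ ≐ ⟪ y ⟫) (proj₁ o′)) (close σ (equations xs ys _) (proj₂ o′))
      (λ x≐y → true-equations σ xs ys o (proj₂ o′)
        (λ eq → h (cong₂ _∷_ (Equivalence.to (true-⟪⟫≐⟪⟫ σ x y (proj₁ o′)) x≐y) eq)))

  truth-pred-⟪⟫ : ∀ σ p {n} (xs : Vec Var (suc n)) .(o : All 𝓛 (Vec.map ⟪_⟫ xs)) →
                  (truth (close σ (pred p (Vec.map ⟪_⟫ xs)) o) ≡ true) ⇔
                  rel p n (Vec.map (⟦_⟧ ∘ at σ) xs)
  truth-pred-⟪⟫ σ p {n} xs o = mk⇔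
    (λ h → subst (rel p n) (sym map-at)
      (Equivalence.to (truth-pred p (Vec.map (at σ) xs)) (trans (cong truth (sym closed)) h)))
    (λ h → trans (cong truth closed)
      (Equivalence.from (truth-pred p (Vec.map (at σ) xs)) (subst (rel p n) map-at h)))
    where
    closed = close-pred-⟪⟫ σ p xs o
    map-at = Vec.map-∘ ⟦_⟧ (at σ) xs

  -- Closing off one variable does not disturb the later ones, because the list
  -- put in is closed.

  closeOff-value : ∀ σ xs (F : FormulaIn (List.map proj₁ (List.map (λ x → x , at σ x) xs))) →
                   value (closeOff (List.map (λ x → x , at σ x) xs) F) ≡
                   inst id (value σ) (value F)
  closeOff-value σ []       (F , [ p ]) =
    sym (inst-idle (value σ) F (λ y y∈ → ⊥-elim-irr (∉[] (proj₂ p y y∈))))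
  closeOff-value σ (x ∷ xs) F = begin
    value (closeOff (List.map (λ x → x , at σ x) xs) (substFormula F (at σ x)))
      ≡⟨ closeOff-value σ xs (substFormula F (at σ x)) ⟩
    inst id (value σ) (SbF (value F) (value σ x) x)
      ≡⟨ inst-SbF id (value σ) (value F) (value σ x) x (CF-closed (value F) x (closed-∉ (at σ x))) ⟩
    inst id (value σ [ x ↦ bind id (value σ) (value σ x) ]) (value F)
      ≡⟨ cong (λ t → inst id (value σ [ x ↦ t ]) (value F)) (bind-idle (value σ) (value σ x) (closed-∉ (at σ x))) ⟩
    inst id (value σ [ x ↦ value σ x ]) (value F)
      ≡⟨ inst-cong-≗ id (value F) (↦-same (value σ) x) ⟩
    inst id (value σ) (value F) ∎
    where open ≡-Reasoning

  valid⇒true : ∀ {F} .(o : Over 𝓛 F) .(ô : Over 𝓛̂ (mapFormula inj₁ F)) →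
               Valid (mapFormula inj₁ F) ô → True F o
  valid⇒true {F} o ô valid σ with finite-unique (finite-free (mapFormula inj₁ F))
  ... | xs , unique , free = trans (cong truth (value-injective (sym (trans
      (closeOff-value σ xs _) (inst-map inj₁ (value σ) F)))))
    (valid bs (subst Unique (sym domain) unique)
              (λ y → subst (λ ys → y ∈free mapFormula inj₁ F ⇔ y ∈ ys) (sym domain) (free y)))
    where
    bs = List.map (λ x → x , at σ x) xs
    domain : List.map proj₁ bs ≡ xs
    domain = trans (sym (map-∘ xs)) (map-id xs)

  true-∃-def : ∀ x {F} .(o : Over 𝓛 F) → True (¬̇ ∀̇ x (¬̇ F) ↔̇ ∃̇ x F) (o , o)
  true-∃-def x {F} o σ = begin
    truth (close σ (¬̇ ∀̇ x (¬̇ F) ↔̇ ∃̇ x F) (o , o))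
      ≡⟨ truth-↔ (close σ (¬̇ ∀̇ x (¬̇ F)) o) (close σ (∃̇ x F) o) ⟩
    truth (close σ (¬̇ ∀̇ x (¬̇ F)) o) ↔ᵇ truth (close σ (∃̇ x F) o)
      ≡⟨ cong (_↔ᵇ truth (close σ (∃̇ x F) o)) (truth-¬ (close σ (∀̇ x (¬̇ F)) o)) ⟩
    not (truth (close σ (∀̇ x (¬̇ F)) o)) ↔ᵇ truth (close σ (∃̇ x F) o)
      ≡⟨ lemma (truth (close σ (∀̇ x (¬̇ F)) o)) (truth (close σ (∃̇ x F) o)) disjoint cover ⟩
    true ∎
    where
    open ≡-Reasoning
    lemma : ∀ a b → (a ≡ true → b ≡ false) → (b ≡ false → a ≡ true) → (not a ↔ᵇ b) ≡ true
    lemma true  true  d c = sym (d refl)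
    lemma true  false d c = refl
    lemma false true  d c = refl
    lemma false false d c = c refl

    truth-¬F : ∀ l → truth (close (σ [ x ≔ l ]) (¬̇ F) o) ≡ not (truth (close (σ [ x ≔ l ]) F o))
    truth-¬F l = truth-¬ (close (σ [ x ≔ l ]) F o)

    disjoint : truth (close σ (∀̇ x (¬̇ F)) o) ≡ true → truth (close σ (∃̇ x F) o) ≡ false
    disjoint h = ¬-not λ e →
      let l , q = Equivalence.to (truth-close-∃ x σ F o) e
      in contradiction (trans (sym (Equivalence.to (truth-close-∀ x σ (¬̇ F) o) h l))
                              (trans (truth-¬F l) (cong not q))) λ ()

    cover : truth (close σ (∃̇ x F) o) ≡ false → truth (close σ (∀̇ x (¬̇ F)) o) ≡ true
    cover e = Equivalence.from (truth-close-∀ x σ (¬̇ F) o) λ l →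
      trans (truth-¬F l) (cong not (¬-not λ q →
        contradiction (trans (sym e) (Equivalence.from (truth-close-∃ x σ F o) (l , q))) λ ()))

  -- By induction on the proof of F

  sound : ∀ {F} → Provable S F → .(o : Over 𝓛 F) → True F o
  sound (basis {F} F∈B) o = valid⇒true o (B̂-over (F , F∈B , refl)) (basis-valid (F , F∈B , refl))
  sound (tautology α taut F oF) o = true-tautology α taut F oF o
  sound (≐-refl x) o σ = Equivalence.from (true-⟪⟫≐⟪⟫ σ x x o) refl
  sound (≐-subst x y {s} {t} s∈ t∈) o σ =
    →-intro (close σ (SbF (s ≐ t) ⟪ x ⟫ y) (proj₁ o))
            (close σ (⟪ x ⟫ ≐ ⟪ y ⟫ →̇ s ≐ t) (proj₂ o)) λ s′≐t′ →
    →-intro (close σ (⟪ x ⟫ ≐ ⟪ y ⟫) (proj₁ (proj₂ o))) (close σ (s ≐ t) (s∈ , t∈)) λ x≐y →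
    let ⟦x⟧≡⟦y⟧ = Equivalence.to (true-⟪⟫≐⟪⟫ σ x y (proj₁ (proj₂ o))) x≐y in
    Equivalence.from (truth-≐ (closeList σ s s∈) (closeList σ t t∈))
      (trans (sym (closeList-replace σ x y s∈ (proj₁ (proj₁ o)) ⟦x⟧≡⟦y⟧))
        (trans (Equivalence.to (truth-≐ (closeList σ _ (proj₁ (proj₁ o)))
                                        (closeList σ _ (proj₂ (proj₁ o)))) s′≐t′)
          (closeList-replace σ x y t∈ (proj₂ (proj₁ o)) ⟦x⟧≡⟦y⟧)))
  sound (≐-pred p {n} xs ys) o σ = true-equations σ xs ys (oxs , oys) o λ eq →
    →-intro (close σ (pred p (Vec.map ⟪_⟫ xs)) oxs) (close σ (pred p (Vec.map ⟪_⟫ ys)) oys) λ h →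
    Equivalence.from (truth-pred-⟪⟫ σ p ys oys)
      (subst (rel p n) eq (Equivalence.to (truth-pred-⟪⟫ σ p xs oxs) h))
    where
    oxs = variables-over S xs
    oys = variables-over S ys
  sound (∀-elim x {F} _) o σ =
    →-intro (close σ (∀̇ x F) (proj₁ o)) (close σ F (proj₂ o)) λ h →
    trans (cong truth (value-injective (sym (inst-cong-≗ inj₁ F (↦-same (value σ) x)))))
          (Equivalence.to (truth-close-∀ x σ F (proj₁ o)) h (at σ x))
  sound (∀-distrib x {F} {G} oF oG x∉F) o σ =
    →-intro (close σ (∀̇ x (F →̇ G)) (oF , oG)) (close σ (F →̇ ∀̇ x G) (oF , oG)) λ h →
    →-intro (close σ F oF) (close σ (∀̇ x G) oG) λ f →
    Equivalence.from (truth-close-∀ x σ G oG) λ l →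
    →-elim (close (σ [ x ≔ l ]) F oF) (close (σ [ x ≔ l ]) G oG)
      (Equivalence.to (truth-close-∀ x σ (F →̇ G) (oF , oG)) h l)
      (trans (cong truth (value-injective (inst-cong inj₁ F
        (λ y y∈F → ↦-miss (value σ) (value l) λ { refl → x∉F y∈F })))) f)
  sound (∃-def x oF) o = true-∃-def x oF
  sound (mp {F} {G} p q) o σ =
    →-elim (close σ F oF) (close σ G o) (sound q (oF , o) σ) (sound p oF σ)
    where oF = Provable⇒Over S p
  sound (subst-rule {F} x {t} t∈ cf p) o σ =
    trans (cong truth (value-injective (inst-SbF inj₁ (value σ) F t x cf)))
          (sound p (Provable⇒Over S p) (σ [ x ≔ closeList σ t t∈ ]))
  sound (gen {F} x p) o σ =
    Equivalence.from (truth-close-∀ x σ F o) (λ l → sound p o (σ [ x ≔ l ]))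

  anyAssignment : Assignment
  anyAssignment with nameOf inhabitant
  ... | l , [ p ] = (λ _ → l) , [ (λ _ → p) ]

  consistent : Consistent S
  consistent contradictory = contradiction
    (trans (sym (sound (contradictory (¬̇ 𝐱≐𝐱) o) o anyAssignment))
      (trans (truth-¬ (close anyAssignment 𝐱≐𝐱 o))
             (cong not (sound (≐-refl 0) o anyAssignment))))
    λ ()
    where
    𝐱≐𝐱 : Formula A P
    𝐱≐𝐱 = ⟪ 0 ⟫ ≐ ⟪ 0 ⟫
    o : Over 𝓛 𝐱≐𝐱
    o = 𝓛-var 0 , 𝓛-var 0

corollary3p6 : ∀ {ℓ} (S : System ℓ) → Model S → Consistent S
corollary3p6 S D = consistent D
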